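{- For every two matrices $C\in\mathbb{B}^{\ell\times m}$ and $D\in\mathbb{B}^{\ell\times n}$, there is a Presburger formula $\textsf{COMP-BiREG}_{C,D}(\bar X,\bar Y)$ with free variables $\bar X=(X_1,\dots,X_m)$, $\bar Y=(Y_1,\dots,Y_n)$ such that for all $\bar M\in\mathbb{N}^m,\bar N\in\mathbb{N}^n$: there exists a $(C,D)$-complete-biregular graph of size $(\bar M,\bar N)$ if and only if $\textsf{COMP-BiREG}_{C,D}(\bar M,\bar N)$ holds.
   Context: A Presburger formula is a first-order formula with $+,\le,0,1$ interpreted over $\mathbb{N}=\{0,1,2,\dots\}$. Let $\mathbb{B}=\mathbb{N}\cup\{{\ge}d \mid d\in\mathbb{N}\}$, where "$x={\ge}d$" means $x\ge d$. An $\ell$-type bipartite graph is $G=(U,V,E_1,\dots,E_\ell)$ with $E_1,\dots,E_\ell$ pairwise disjoint subsets of $U\times V$; $\deg_{E_i}(u)$ is the number of $E_i$-edges incident to $u$. $G$ is $(C,D)$-biregular if there are partitions $U=U_1\cup\dots\cup U_m$, $V=V_1\cup\dots\cup V_n$ (parts may be empty) with $\deg_{E_i}(u)=C_{i,j}$ for all $u\in U_j$ and $\deg_{E_i}(v)=D_{i,j}$ for all $v\in V_j$, for all $i$; it has size $(\bar M,\bar N)$ if the partitions can be chosen with part sizes $\bar M=(|U_1|,\dots,|U_m|)$, $\bar N=(|V_1|,\dots,|V_n|)$. $G$ is complete if $U\times V=E_1\cup\dots\cup E_\ell$; a $(C,D)$-complete-biregular graph is a complete $(C,D)$-biregular graph.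 -}

module Defs where

open import Data.Nat using (ℕ; zero; suc; _+_; _≤_; _≥_)
open import Data.Fin using (Fin; zero; suc)
open import Data.Bool using (Bool; true; false)
open import Data.Product using (Σ; _×_; _,_)
open import Data.Sum using (_⊎_)
open import Data.Empty using (⊥)
open import Relation.Binary.PropositionalEquality using (_≡_; _≢_)
open import Relation.Nullary using (¬_)
open import Data.Vec.Functional using (Vector; _∷_; _++_)

-- Presburger arithmetic: first-order formulas over (+, ≤, 0, 1),
-- interpreted in ℕ.  Variables are de Bruijn indices: a formula of
-- type  Formula k  has (at most) k free variables, Fin k.

data Term (k : ℕ) : Set where
  var  : Fin k → Term k
  `0   : Term k
  `1   : Term k
  _`+_ : Term k → Term k → Term k

data Formula (k : ℕ) : Set where
  _`≤_ : Term k → Term k → Formula k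
  `¬_  : Formula k → Formula k
  _`∧_ : Formula k → Formula k → Formula k
  _`∨_ : Formula k → Formula k → Formula k
  `∃_  : Formula (suc k) → Formula k
  `∀_  : Formula (suc k) → Formula k

⟦_⟧t : ∀ {k} → Term k → Vector ℕ k → ℕ
⟦ var x ⟧t ρ = ρ x
⟦ `0 ⟧t ρ = 0
⟦ `1 ⟧t ρ = 1
⟦ s `+ t ⟧t ρ = ⟦ s ⟧t ρ + ⟦ t ⟧t ρ

Sat : ∀ {k} → Formula k → Vector ℕ k → Set
Sat (s `≤ t) ρ = ⟦ s ⟧t ρ ≤ ⟦ t ⟧t ρ
Sat (`¬ φ) ρ = ¬ Sat φ ρ
Sat (φ `∧ ψ) ρ = Sat φ ρ × Sat ψ ρ
Sat (φ `∨ ψ) ρ = Sat φ ρ ⊎ Sat ψ ρ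
Sat (`∃ φ) ρ = Σ ℕ λ x → Sat φ (x ∷ ρ)
Sat (`∀ φ) ρ = (x : ℕ) → Sat φ (x ∷ ρ)

data 𝔹 : Set where
  exactly : ℕ → 𝔹
  atLeast : ℕ → 𝔹

_≐_ : ℕ → 𝔹 → Set
x ≐ exactly d = x ≡ d
x ≐ atLeast d = x ≥ d

sumFin : (n : ℕ) → (Fin n → ℕ) → ℕ
sumFin zero f = 0
sumFin (suc n) f = f zero + sumFin n (λ i → f (suc i))

b2n : Bool → ℕ
b2n true = 1
b2n false = 0

countFin : (n : ℕ) → (Fin n → Bool) → ℕ
countFin n P = sumFin n (λ i → b2n (P i))

-- ℓ-type bipartite graphs with finite vertex sets U = Fin p, V = Fin q.
-- Edge relation E i u v = true  iff  (u,v) ∈ E_i.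

record BipGraph (ℓ : ℕ) : Set where
  field
    p q      : ℕ
    E        : Fin ℓ → Fin p → Fin q → Bool
    disjoint : ∀ i j u v → i ≢ j → E i u v ≡ true → E j u v ≡ false

module _ {ℓ : ℕ} (G : BipGraph ℓ) where
  open BipGraph G

  degU : Fin ℓ → Fin p → ℕ
  degU i u = countFin q (λ v → E i u v)

  degV : Fin ℓ → Fin q → ℕ
  degV i v = countFin p (λ u → E i u v)

  Complete : Set
  Complete = ∀ u v → Σ (Fin ℓ) λ i → E i u v ≡ true

partSize : ∀ {p m} → (Fin p → Fin m) → Fin m → ℕ
partSize {p} part j = countFin p (λ u → isEq (part u) j)
  where
  open import Data.Fin using (_≟_)
  open import Relation.Nullary.Decidable using (⌊_⌋)
  isEq : ∀ {m} → Fin m → Fin m → Bool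
  isEq a b = ⌊ a ≟ b ⌋

-- G is (C,D)-biregular of size (M,N): partitions U = U_1 ∪ … ∪ U_m,
-- V = V_1 ∪ … ∪ V_n given by maps to part indices, with |U_j| = M_j,
-- |V_j| = N_j and the degree conditions.
BiregularOfSize : ∀ {ℓ m n} → (C : Fin ℓ → Fin m → 𝔹) → (D : Fin ℓ → Fin n → 𝔹)
                → (M : Vector ℕ m) → (N : Vector ℕ n) → BipGraph ℓ → Set
BiregularOfSize {ℓ} {m} {n} C D M N G =
  Σ (Fin p → Fin m) λ partU →
  Σ (Fin q → Fin n) λ partV →
    (∀ j → partSize partU j ≡ M j) ×
    (∀ j → partSize partV j ≡ N j) ×
    (∀ i u → degU G i u ≐ C i (partU u)) ×
    (∀ i v → degV G i v ≐ D i (partV v))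
  where open BipGraph G

ExistsCompleteBiregular : ∀ {ℓ m n} → (C : Fin ℓ → Fin m → 𝔹) → (D : Fin ℓ → Fin n → 𝔹)
                        → Vector ℕ m → Vector ℕ n → Set
ExistsCompleteBiregular {ℓ} C D M N =
  Σ (BipGraph ℓ) λ G → Complete G × BiregularOfSize C D M N G

{-# OPTIONS --safe #-}
-- A complete graph is an edge colouring Fin p → Fin q → Fin ℓ.  Call colour i
-- free for a vertex if its demand on i is a lower bound.
--
-- If every nonempty class of vertices that matters (the vertices of one part, the
-- vertices with positive demand for one colour) is large, a colouring exists iff
-- any two occurring parts share a free colour and, for each colour i, the demands
-- of the columns sum to at most those of the rows unless i is free for some row,
-- and conversely.  Necessity is double counting.  For sufficiency, realise suitable
-- bounded degrees by a partial colouring built edge by edge, using switchings;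
-- complete first the columns and then the rows greedily, on disjoint sets of
-- entries; colour what remains with colours free for both ends.
--
-- If some class is nonempty but small, delete one of its vertices, splitting the
-- opposite parts according to the colour of the edge to it; the split sizes
-- become existentially quantified variables.  Deletion never enlarges a class,
-- so boundedly many deletions suffice.

module Submission where

open import Defs
open import Data.Bool using (Bool; true; false; not; _∧_; if_then_else_)
open import Data.Bool.Properties using () renaming (_≟_ to _≟ᵇ_; ¬-not to ¬true⇒false)
open import Data.Empty using (⊥; ⊥-elim)
open import Data.Fin using (Fin; zero; suc; punchIn; splitAt; _↑ˡ_; _↑ʳ_; remQuot; combine) renaming (_≟_ to _≟ᶠ_)
open import Data.Fin.Properties using (any?; splitAt-↑ˡ; splitAt-↑ʳ; remQuot-combine)
open import Data.Maybe using (Maybe; just; nothing)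
open import Data.Nat
open import Data.Nat.Properties
open import Data.Nat.Tactic.RingSolver using (solve-∀)
open import Data.Product using (Σ; ∃; ∃₂; _×_; _,_; proj₁; proj₂; swap; map; uncurry)
open import Data.Sum using (_⊎_; inj₁; inj₂; [_,_]′)
open import Data.Vec.Functional using (Vector; _++_; _∷_)
open import Data.Vec.Functional.Properties using (lookup-++ˡ; lookup-++ʳ)
open import Function using (_∘_; flip; id)
open import Function.Bundles using (_⇔_; mk⇔; Equivalence)
open import Relation.Binary.PropositionalEquality
open import Relation.Nullary using (¬_; Dec; yes; no)
open import Relation.Nullary.Decidable using (⌊_⌋; _×-dec_)

-- Finite sums

sum-cong : ∀ n {f g : Fin n → ℕ} → (∀ x → f x ≡ g x) → sumFin n f ≡ sumFin n g
sum-cong zero    e = refl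
sum-cong (suc n) e = cong₂ _+_ (e zero) (sum-cong n (e ∘ suc))

sum-mono : ∀ n {f g : Fin n → ℕ} → (∀ x → f x ≤ g x) → sumFin n f ≤ sumFin n g
sum-mono zero    e = z≤n
sum-mono (suc n) e = +-mono-≤ (e zero) (sum-mono n (e ∘ suc))

sum-mono-< : ∀ n {f g : Fin n → ℕ} → (∀ x → f x ≤ g x) → ∀ x → f x < g x →
             sumFin n f < sumFin n g
sum-mono-< (suc n) e zero    lt = +-mono-<-≤ lt (sum-mono n (e ∘ suc))
sum-mono-< (suc n) e (suc x) lt = +-mono-≤-< (e zero) (sum-mono-< n (e ∘ suc) x lt)

sum-≤-const : ∀ n {f : Fin n → ℕ} {k} → (∀ x → f x ≤ k) → sumFin n f ≤ n * k
sum-≤-const zero    e = z≤n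
sum-≤-const (suc n) e = +-mono-≤ (e zero) (sum-≤-const n (e ∘ suc))

sum-0 : ∀ n → sumFin n (λ _ → 0) ≡ 0
sum-0 zero    = refl
sum-0 (suc n) = sum-0 n

sum-+ : ∀ n (f g : Fin n → ℕ) → sumFin n (λ x → f x + g x) ≡ sumFin n f + sumFin n g
sum-+ zero    f g = refl
sum-+ (suc n) f g rewrite sum-+ n (f ∘ suc) (g ∘ suc) =
  interchange (f zero) (g zero) (sumFin n (f ∘ suc)) (sumFin n (g ∘ suc))
  where
  interchange : ∀ a b c d → a + b + (c + d) ≡ a + c + (b + d)
  interchange = solve-∀

sum-*ˡ : ∀ n c (f : Fin n → ℕ) → sumFin n (λ x → c * f x) ≡ c * sumFin n f
sum-*ˡ zero    c f = sym (*-zeroʳ c)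
sum-*ˡ (suc n) c f rewrite sum-*ˡ n c (f ∘ suc) = sym (*-distribˡ-+ c (f zero) _)

sum-*ʳ : ∀ n c (f : Fin n → ℕ) → sumFin n (λ x → f x * c) ≡ sumFin n f * c
sum-*ʳ n c f = trans (sum-cong n (λ x → *-comm (f x) c))
                     (trans (sum-*ˡ n c f) (*-comm c _))

sum-swap : ∀ n m (f : Fin n → Fin m → ℕ) →
           sumFin n (λ x → sumFin m (f x)) ≡ sumFin m (λ y → sumFin n (λ x → f x y))
sum-swap zero    m f = sym (sum-0 m)
sum-swap (suc n) m f rewrite sum-swap n m (f ∘ suc) =
  sym (sum-+ m (f zero) (λ y → sumFin n (λ x → f (suc x) y)))

term≤sum : ∀ n (f : Fin n → ℕ) x → f x ≤ sumFin n f
term≤sum (suc n) f zero    = m≤m+n _ _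
term≤sum (suc n) f (suc x) = ≤-trans (term≤sum n (f ∘ suc) x) (m≤n+m _ _)

sum≡0⇒term≡0 : ∀ n (f : Fin n → ℕ) → sumFin n f ≡ 0 → ∀ x → f x ≡ 0
sum≡0⇒term≡0 n f e x = n≤0⇒n≡0 (subst (f x ≤_) e (term≤sum n f x))

sum-<-witness : ∀ n (f g : Fin n → ℕ) → sumFin n f < sumFin n g → ∃ λ x → f x < g x
sum-<-witness (suc n) f g lt with f zero <? g zero
... | yes p = zero , p
... | no ¬p = let x , q = sum-<-witness n (f ∘ suc) (g ∘ suc)
                            (+-cancelˡ-< (g zero) _ _
                              (≤-<-trans (+-monoˡ-≤ _ (≮⇒≥ ¬p)) lt))
              in suc x , q

sum-≤-≥⇒≡ : ∀ n (f g : Fin n → ℕ) → (∀ x → f x ≤ g x) → sumFin n g ≤ sumFin n f →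
            ∀ x → f x ≡ g x
sum-≤-≥⇒≡ n f g le ge x with f x <? g x
... | yes lt = ⊥-elim (<⇒≱ (sum-mono-< n le x lt) ge)
... | no ¬lt = ≤-antisym (le x) (≮⇒≥ ¬lt)

sum-punchIn : ∀ n (f : Fin (suc n) → ℕ) x →
              sumFin (suc n) f ≡ f x + sumFin n (f ∘ punchIn x)
sum-punchIn n       f zero    = refl
sum-punchIn (suc n) f (suc x) rewrite sum-punchIn n (f ∘ suc) x =
  left-comm (f zero) (f (suc x)) _
  where
  left-comm : ∀ a b c → a + (b + c) ≡ b + (a + c)
  left-comm = solve-∀

δ : ∀ {n} → Fin n → Fin n → ℕ
δ x y = b2n ⌊ x ≟ᶠ y ⌋

δ-refl : ∀ {n} (x : Fin n) → δ x x ≡ 1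
δ-refl x with x ≟ᶠ x
... | yes _ = refl
... | no ne = ⊥-elim (ne refl)

δ-≢ : ∀ {n} {x y : Fin n} → x ≢ y → δ x y ≡ 0
δ-≢ {x = x} {y} ne with x ≟ᶠ y
... | yes e = ⊥-elim (ne e)
... | no _  = refl

δ-suc : ∀ {n} (x y : Fin n) → δ (suc x) (suc y) ≡ δ x y
δ-suc x y with x ≟ᶠ y
... | yes _ = refl
... | no _  = refl

δ>0⇒≡ : ∀ {n} {x y : Fin n} → 0 < δ x y → x ≡ y
δ>0⇒≡ {x = x} {y} lt with x ≟ᶠ y
... | yes e = e

sum-δ : ∀ n x (g : Fin n → ℕ) → sumFin n (λ y → δ x y * g y) ≡ g x
sum-δ (suc n) zero    g =
  trans (cong (1 * g zero +_) (sum-0 n)) (trans (+-identityʳ _) (*-identityˡ _))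
sum-δ (suc n) (suc x) g =
  trans (sum-cong n (λ y → cong (_* g (suc y)) (δ-suc x y))) (sum-δ n x (g ∘ suc))

sum-δ₁ : ∀ n (x : Fin n) → sumFin n (δ x) ≡ 1
sum-δ₁ n x = trans (sum-cong n (λ y → sym (*-identityʳ _))) (sum-δ n x (λ _ → 1))

sum-fibre : ∀ {p m} (t : Fin p → Fin m) (g : Fin m → ℕ) →
            sumFin m (λ j → g j * partSize t j) ≡ sumFin p (g ∘ t)
sum-fibre {p} {m} t g = begin
  sumFin m (λ j → g j * sumFin p (λ u → δ (t u) j))
    ≡⟨ sum-cong m (λ j → sym (sum-*ˡ p (g j) (λ u → δ (t u) j))) ⟩
  sumFin m (λ j → sumFin p (λ u → g j * δ (t u) j))
    ≡⟨ sum-swap m p _ ⟩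
  sumFin p (λ u → sumFin m (λ j → g j * δ (t u) j))
    ≡⟨ sum-cong p (λ u → trans (sum-cong m (λ j → *-comm (g j) _)) (sum-δ m (t u) g)) ⟩
  sumFin p (g ∘ t) ∎
  where open ≡-Reasoning

true≢false : ∀ {b : Bool} → b ≡ true → b ≡ false → ⊥
true≢false refl ()

b2n≤1 : ∀ b → b2n b ≤ 1
b2n≤1 true  = ≤-refl
b2n≤1 false = z≤n

bump≤ : ∀ {n} (z x : Fin n) a b → a ≤ b → (z ≡ x → a < b) → a + δ z x ≤ b
bump≤ z x a b le lt with z ≟ᶠ x
... | yes e = subst (_≤ b) (+-comm 1 a) (lt e)
... | no _  = subst (_≤ b) (sym (+-identityʳ a)) le

-- A discrete intermediate value argument: starting from `lo`, a coordinate still below `hi` is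
-- raised by one until the sum has reached `s`.
sum-interpolate : ∀ n (lo hi : Fin n → ℕ) → (∀ x → lo x ≤ hi x) → ∀ s →
                  sumFin n lo ≤ s → s ≤ sumFin n hi →
                  ∃ λ y → (∀ x → lo x ≤ y x) × (∀ x → y x ≤ hi x) × sumFin n y ≡ s
sum-interpolate n lo hi lo≤hi s lo≤s s≤hi with ≤⇒≤′ lo≤s
... | ≤′-refl = lo , (λ _ → ≤-refl) , lo≤hi , refl
... | ≤′-step {s′} lt =
  let y , lo≤y , y≤hi , Σy = sum-interpolate n lo hi lo≤hi s′ (≤′⇒≤ lt) (<⇒≤ s≤hi)
      z , y<hi = sum-<-witness n y hi (subst (_< _) (sym Σy) s≤hi)
  in (λ x → y x + δ z x)
   , (λ x → ≤-trans (lo≤y x) (m≤m+n _ _))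
   , (λ x → bump≤ z x (y x) (hi x) (y≤hi x) (λ { refl → y<hi }))
   , trans (sum-+ n y (δ z)) (trans (cong₂ _+_ Σy (sum-δ₁ n z)) (+-comm s′ 1))

-- Partial colourings

μ : ∀ {ℓ} → Maybe (Fin ℓ) → Fin ℓ → ℕ
μ nothing  i = 0
μ (just j) i = δ j i

occ : ∀ {ℓ} → Maybe (Fin ℓ) → ℕ
occ nothing  = 0
occ (just _) = 1

occ≡Σμ : ∀ {ℓ} (x : Maybe (Fin ℓ)) → occ x ≡ sumFin ℓ (μ x)
occ≡Σμ {ℓ} nothing  = sym (sum-0 ℓ)
occ≡Σμ {ℓ} (just j) = sym (sum-δ₁ ℓ j)

occ<1⇒nothing : ∀ {ℓ} (x : Maybe (Fin ℓ)) → occ x < 1 → x ≡ nothing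
occ<1⇒nothing nothing  _ = refl
occ<1⇒nothing (just _) (s≤s ())

μ>0⇒just : ∀ {ℓ} (x : Maybe (Fin ℓ)) i → 0 < μ x i → x ≡ just i
μ>0⇒just (just j) i lt = cong just (δ>0⇒≡ lt)

deg : ∀ {n ℓ} → (Fin n → Maybe (Fin ℓ)) → Fin ℓ → ℕ
deg {n} g i = sumFin n (λ x → μ (g x) i)

PColouring : ℕ → ℕ → ℕ → Set
PColouring p q ℓ = Fin p → Fin q → Maybe (Fin ℓ)

module _ {p q ℓ : ℕ} where

  degR : PColouring p q ℓ → Fin p → Fin ℓ → ℕ
  degR f u = deg (f u)

  degC : PColouring p q ℓ → Fin q → Fin ℓ → ℕ
  degC f v = deg (λ u → f u v)

  Σ-degR≡Σ-degC : ∀ f i → sumFin p (λ u → degR f u i) ≡ sumFin q (λ v → degC f v i)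
  Σ-degR≡Σ-degC f i = sum-swap p q (λ u v → μ (f u v) i)

  set : PColouring p q ℓ → Fin p → Fin q → Maybe (Fin ℓ) → PColouring p q ℓ
  set f u v y u′ v′ = if ⌊ u ≟ᶠ u′ ⌋ ∧ ⌊ v ≟ᶠ v′ ⌋ then y else f u′ v′

  set-≢ : ∀ f u v y {u′ v′} → u ≢ u′ ⊎ v ≢ v′ → set f u v y u′ v′ ≡ f u′ v′
  set-≢ f u v y {u′} {v′} ne with u ≟ᶠ u′ | v ≟ᶠ v′
  ... | no _  | _     = refl
  ... | yes _ | no _  = refl
  set-≢ f u v y (inj₁ ne) | yes e | yes _ = ⊥-elim (ne e)
  set-≢ f u v y (inj₂ ne) | yes _ | yes e = ⊥-elim (ne e)

  -- The old entry is added on the left rather than subtracted on the right, which keeps truncated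
  -- subtraction out of the degree counts.
  μ-set : ∀ f u v y u′ v′ i →
          μ (set f u v y u′ v′) i + δ u u′ * (δ v v′ * μ (f u v) i) ≡
          μ (f u′ v′) i + δ u u′ * (δ v v′ * μ y i)
  μ-set f u v y u′ v′ i with u ≟ᶠ u′ | v ≟ᶠ v′
  ... | no _     | _        = refl
  ... | yes _    | no _     = refl
  ... | yes refl | yes refl = swap′ (μ y i) (μ (f u v) i)
    where
    swap′ : ∀ a b → a + 1 * (1 * b) ≡ b + 1 * (1 * a)
    swap′ = solve-∀

  degR-set : ∀ f u v y u′ i →
             degR (set f u v y) u′ i + δ u u′ * μ (f u v) i ≡ degR f u′ i + δ u u′ * μ y i
  degR-set f u v y u′ i = begin
    degR (set f u v y) u′ i + δ u u′ * μ (f u v) i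
      ≡⟨ cong (degR (set f u v y) u′ i +_) (sym (pull (μ (f u v) i))) ⟩
    degR (set f u v y) u′ i + sumFin q (λ v′ → δ u u′ * (δ v v′ * μ (f u v) i))
      ≡⟨ sym (sum-+ q _ _) ⟩
    sumFin q (λ v′ → μ (set f u v y u′ v′) i + δ u u′ * (δ v v′ * μ (f u v) i))
      ≡⟨ sum-cong q (λ v′ → μ-set f u v y u′ v′ i) ⟩
    sumFin q (λ v′ → μ (f u′ v′) i + δ u u′ * (δ v v′ * μ y i))
      ≡⟨ sum-+ q _ _ ⟩
    degR f u′ i + sumFin q (λ v′ → δ u u′ * (δ v v′ * μ y i))
      ≡⟨ cong (degR f u′ i +_) (pull (μ y i)) ⟩
    degR f u′ i + δ u u′ * μ y i ∎
    where
    open ≡-Reasoning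
    pull : ∀ c → sumFin q (λ v′ → δ u u′ * (δ v v′ * c)) ≡ δ u u′ * c
    pull c = trans (sum-*ˡ q (δ u u′) _) (cong (δ u u′ *_) (sum-δ q v (λ _ → c)))

  degC-set : ∀ f u v y v′ i →
             degC (set f u v y) v′ i + δ v v′ * μ (f u v) i ≡ degC f v′ i + δ v v′ * μ y i
  degC-set f u v y v′ i = begin
    degC (set f u v y) v′ i + δ v v′ * μ (f u v) i
      ≡⟨ cong (degC (set f u v y) v′ i +_) (sym (sum-δ p u _)) ⟩
    degC (set f u v y) v′ i + sumFin p (λ u′ → δ u u′ * (δ v v′ * μ (f u v) i))
      ≡⟨ sym (sum-+ p _ _) ⟩
    sumFin p (λ u′ → μ (set f u v y u′ v′) i + δ u u′ * (δ v v′ * μ (f u v) i))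
      ≡⟨ sum-cong p (λ u′ → μ-set f u v y u′ v′ i) ⟩
    sumFin p (λ u′ → μ (f u′ v′) i + δ u u′ * (δ v v′ * μ y i))
      ≡⟨ sum-+ p _ _ ⟩
    degC f v′ i + sumFin p (λ u′ → δ u u′ * (δ v v′ * μ y i))
      ≡⟨ cong (degC f v′ i +_) (sum-δ p u _) ⟩
    degC f v′ i + δ v v′ * μ y i ∎
    where open ≡-Reasoning

  -- Only degrees are compared, so a rearrangement of several entries can count as one new edge.
  -- Read from `f′` to `f`, it describes a deletion.
  Adds : (f f′ : PColouring p q ℓ) → Fin p → Fin q → Fin ℓ → Set
  Adds f f′ u v i = (∀ u′ i′ → degR f′ u′ i′ ≡ degR f u′ i′ + δ u u′ * δ i i′) ×
                    (∀ v′ i′ → degC f′ v′ i′ ≡ degC f v′ i′ + δ v v′ * δ i i′)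

  set-adds : ∀ f u v i → f u v ≡ nothing → Adds f (set f u v (just i)) u v i
  set-adds f u v i e = (λ u′ i′ → drop i′ (δ u u′) (degR-set f u v (just i) u′ i′))
                     , (λ v′ i′ → drop i′ (δ v v′) (degC-set f u v (just i) v′ i′))
    where
    drop : ∀ i′ {a b} c → a + c * μ (f u v) i′ ≡ b → a ≡ b
    drop i′ c h rewrite e | *-zeroʳ c = trans (sym (+-identityʳ _)) h

  set-removes : ∀ f u v i → f u v ≡ just i → Adds (set f u v nothing) f u v i
  set-removes f u v i e = (λ u′ i′ → drop i′ _ (δ u u′) (degR-set f u v nothing u′ i′))
                        , (λ v′ i′ → drop i′ _ (δ v v′) (degC-set f u v nothing v′ i′))
    where
    drop : ∀ i′ a {b} c → a + c * μ (f u v) i′ ≡ b + c * 0 → b ≡ a + c * δ i i′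
    drop i′ a c h rewrite e | *-zeroʳ c = sym (trans h (+-identityʳ _))

  -- The edge at `u′ v′` is replaced by edges at `u v′` and `u′ v`. Row `u′` and column `v′` lose
  -- one and gain one, so only row `u` and column `v` change. The entry `u v` may already be
  -- coloured.
  switch : ∀ f u v u′ v′ i → f u′ v′ ≡ just i → f u v′ ≡ nothing → f u′ v ≡ nothing →
           ∃ λ f′ → Adds f f′ u v i
  switch f u v u′ v′ i e₁ e₂ e₃ =
    f₃ , (λ w j → cancelR {x = δ u′ w * δ i j} (proj₁ A₁ w j) (proj₁ A₂ w j) (proj₁ A₃ w j))
       , (λ w j → cancelC {x = δ v′ w * δ i j} (proj₂ A₁ w j) (proj₂ A₂ w j) (proj₂ A₃ w j))
    where
    clash : ∀ {A : Set} {x : A} {m : Maybe A} → m ≡ just x → m ≡ nothing → ⊥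
    clash refl ()
    u′≢u : u′ ≢ u
    u′≢u refl = clash e₁ e₂
    v′≢v : v′ ≢ v
    v′≢v refl = clash e₁ e₃
    f₁ f₂ f₃ : PColouring p q ℓ
    f₁ = set f u′ v′ nothing
    f₂ = set f₁ u v′ (just i)
    f₃ = set f₂ u′ v (just i)
    A₁ : Adds f₁ f u′ v′ i
    A₁ = set-removes f u′ v′ i e₁
    A₂ : Adds f₁ f₂ u v′ i
    A₂ = set-adds f₁ u v′ i (trans (set-≢ f u′ v′ nothing (inj₁ u′≢u)) e₂)
    A₃ : Adds f₂ f₃ u′ v i
    A₃ = set-adds f₂ u′ v i (trans (set-≢ f₁ u v′ (just i) (inj₂ v′≢v))
                              (trans (set-≢ f u′ v′ nothing (inj₂ v′≢v)) e₃))
    comm : ∀ a b c → (a + b) + c ≡ (a + c) + b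
    comm = solve-∀
    cancelR : ∀ {d d₁ d₂ d₃ x y} → d ≡ d₁ + x → d₂ ≡ d₁ + y → d₃ ≡ d₂ + x → d₃ ≡ d + y
    cancelR {d₁ = d₁} {x = x} {y} refl refl refl = comm d₁ y x
    cancelC : ∀ {d d₁ d₂ d₃ x y} → d ≡ d₁ + x → d₂ ≡ d₁ + x → d₃ ≡ d₂ + y → d₃ ≡ d + y
    cancelC refl refl refl = refl

-- Exact realisation of bounded degrees by switchings

Σocc≡Σdeg : ∀ {n ℓ} (g : Fin n → Maybe (Fin ℓ)) →
            sumFin n (λ x → occ (g x)) ≡ sumFin ℓ (deg g)
Σocc≡Σdeg {n} {ℓ} g = trans (sum-cong n (λ x → occ≡Σμ (g x))) (sum-swap n ℓ _)

-- Used after averaging: a position whose weight exceeds its weight times the number of its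
-- obstructions has no obstruction.
m*n<m⇒n<1 : ∀ m n → m * n < m → n < 1
m*n<m⇒n<1 m zero    lt = s≤s z≤n
m*n<m⇒n<1 m (suc n) lt = ⊥-elim (<⇒≱ lt (m≤m*n m (suc n)))

module Core {p q ℓ : ℕ} (k : ℕ)
  (a : Fin p → Fin ℓ → ℕ) (b : Fin q → Fin ℓ → ℕ)
  (a≤k : ∀ u i → a u i ≤ k) (b≤k : ∀ v i → b v i ≤ k)
  (Σa≡Σb : ∀ i → sumFin p (λ u → a u i) ≡ sumFin q (λ v → b v i))
  (zero∨large : ∀ i → sumFin p (λ u → a u i) ≡ 0 ⊎ 3 * (k * (ℓ * k)) < sumFin p (λ u → a u i))
  where

  W : ℕ
  W = k * (ℓ * k)

  Within : PColouring p q ℓ → Set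
  Within f = (∀ u i → degR f u i ≤ a u i) × (∀ v i → degC f v i ≤ b v i)

  -- A line carries at most `k` entries of each of the `ℓ` colours, hence at most `ℓ * k` coloured
  -- entries, each of weight at most `k`.
  weighted-load : ∀ {n} (w : Fin n → ℕ) (g : Fin n → Maybe (Fin ℓ)) →
                  (∀ x → w x ≤ k) → (∀ i → deg g i ≤ k) →
                  sumFin n (λ x → w x * occ (g x)) ≤ W
  weighted-load {n} w g w≤k deg≤k = begin
    sumFin n (λ x → w x * occ (g x)) ≤⟨ sum-mono n (λ x → *-monoˡ-≤ (occ (g x)) (w≤k x)) ⟩
    sumFin n (λ x → k * occ (g x))   ≡⟨ sum-*ˡ n k _ ⟩
    k * sumFin n (λ x → occ (g x))   ≡⟨ cong (k *_) (Σocc≡Σdeg g) ⟩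
    k * sumFin ℓ (deg g)             ≤⟨ *-monoʳ-≤ k (sum-≤-const ℓ deg≤k) ⟩
    W ∎
    where open ≤-Reasoning

  -- The row that gains the edge need not be `u`: for termination of `saturate` it only matters that
  -- the total degree grows within the bounds.
  augment : ∀ f → Within f → ∀ u i → degR f u i < a u i →
            ∃ λ f′ → ∃₂ λ u⁺ v⁺ → Adds f f′ u⁺ v⁺ i × degR f u⁺ i < a u⁺ i × degC f v⁺ i < b v⁺ i
  augment f (R≤ , C≤) u i u-def with zero∨large i
  ... | inj₁ z = ⊥-elim (<⇒≱ (≤-<-trans z≤n u-def)
                   (≤-reflexive (sum≡0⇒term≡0 p (λ u → a u i) z u)))
  -- Many `i`-edges guarantee one that can be switched; few leave much slack in the rows. Of the
  -- factor 3 in the hypothesis, 2 pays for obstructed edges and 1 for slack in occupied positions.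
  ... | inj₂ large = step (2 * W <? e)
    where
    open ≤-Reasoning
    e : ℕ
    e = sumFin p (λ u → degR f u i)
    v-witness : ∃ λ v → degC f v i < b v i
    v-witness = sum-<-witness q _ _ (begin-strict
      sumFin q (λ v → degC f v i) ≡⟨ sym (Σ-degR≡Σ-degC f i) ⟩
      e                           <⟨ sum-mono-< p (λ u → R≤ u i) u u-def ⟩
      sumFin p (λ u → a u i)      ≡⟨ Σa≡Σb i ⟩
      sumFin q (λ v → b v i)      ∎)
    v : Fin q
    v = proj₁ v-witness
    v-def : degC f v i < b v i
    v-def = proj₂ v-witness
    Rk : ∀ u i → degR f u i ≤ k
    Rk u i = ≤-trans (R≤ u i) (a≤k u i)
    Ck : ∀ v i → degC f v i ≤ k
    Ck v i = ≤-trans (C≤ v i) (b≤k v i)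

    -- Each `i`-edge at `u′ v′` is weighted by the number of coloured entries among `u v′` and
    -- `u′ v` that prevent its switching.
    blocked : Fin p → Fin q → ℕ
    blocked u′ v′ = μ (f u′ v′) i * (occ (f u v′) + occ (f u′ v))
    Σblocked : sumFin p (λ u′ → sumFin q (blocked u′)) ≤ 2 * W
    Σblocked = begin
      sumFin p (λ u′ → sumFin q (blocked u′))
        ≡⟨ sum-cong p (λ u′ → trans
             (sum-cong q (λ v′ → *-distribˡ-+ (μ (f u′ v′) i) (occ (f u v′)) (occ (f u′ v))))
             (sum-+ q _ _)) ⟩
      sumFin p (λ u′ → sumFin q (λ v′ → μ (f u′ v′) i * occ (f u v′)) +
                       sumFin q (λ v′ → μ (f u′ v′) i * occ (f u′ v)))
        ≡⟨ sum-+ p _ _ ⟩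
      sumFin p (λ u′ → sumFin q (λ v′ → μ (f u′ v′) i * occ (f u v′))) +
      sumFin p (λ u′ → sumFin q (λ v′ → μ (f u′ v′) i * occ (f u′ v)))
        ≡⟨ cong₂ _+_
             (trans (sum-swap p q _) (sum-cong q (λ v′ → sum-*ʳ p (occ (f u v′)) _)))
             (sum-cong p (λ u′ → sum-*ʳ q (occ (f u′ v)) _)) ⟩
      sumFin q (λ v′ → degC f v′ i * occ (f u v′)) +
      sumFin p (λ u′ → degR f u′ i * occ (f u′ v))
        ≤⟨ +-mono-≤ (weighted-load (λ v′ → degC f v′ i) (f u) (λ v′ → Ck v′ i) (Rk u))
                    (weighted-load (λ u′ → degR f u′ i) (λ u′ → f u′ v) (λ u′ → Rk u′ i) (Ck v)) ⟩
      W + W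
        ≡⟨ cong (W +_) (sym (+-identityʳ W)) ⟩
      2 * W ∎

    step : Dec (2 * W < e) →
           ∃ λ f′ → ∃₂ λ u⁺ v⁺ → Adds f f′ u⁺ v⁺ i × degR f u⁺ i < a u⁺ i × degC f v⁺ i < b v⁺ i
    step (yes many) =
      let u′ , lt  = sum-<-witness p (λ u′ → sumFin q (blocked u′)) (λ u′ → degR f u′ i)
                       (≤-<-trans Σblocked many)
          v′ , lt′ = sum-<-witness q (blocked u′) (λ v′ → μ (f u′ v′) i) lt
          free     = m*n<m⇒n<1 (μ (f u′ v′) i) _ lt′
          f′ , adds = switch f u v u′ v′ i
            (μ>0⇒just (f u′ v′) i (≤-<-trans z≤n lt′))
            (occ<1⇒nothing (f u v′) (≤-<-trans (m≤m+n _ _) free))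
            (occ<1⇒nothing (f u′ v) (≤-<-trans (m≤n+m _ _) free))
      in f′ , u , v , adds , u-def , v-def
    step (no few) =
      -- Rows already coloured in column `v` hold slack at most `W` altogether, so some row with
      -- positive slack is still uncoloured there.
      let u′ , lt = sum-<-witness p (λ u′ → slack u′ * occ (f u′ v)) slack
                      (≤-<-trans (weighted-load slack (λ u′ → f u′ v) slack≤k (Ck v)) slack-large)
      in set f u′ v (just i) , u′ , v
       , set-adds f u′ v i (occ<1⇒nothing (f u′ v) (m*n<m⇒n<1 (slack u′) _ lt))
       , m∸n≢0⇒n<m (λ z → <⇒≱ (≤-<-trans z≤n lt) (≤-reflexive z))
       , v-def
      where
      slack : Fin p → ℕ
      slack u′ = a u′ i ∸ degR f u′ i
      slack≤k : ∀ u′ → slack u′ ≤ k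
      slack≤k u′ = ≤-trans (m∸n≤m _ (degR f u′ i)) (a≤k u′ i)
      slack-large : W < sumFin p slack
      slack-large = +-cancelʳ-< (2 * W) _ _ (begin-strict
        W + 2 * W                             <⟨ large ⟩
        sumFin p (λ u′ → a u′ i)              ≡⟨ sum-cong p (λ u′ → sym (m∸n+n≡m (R≤ u′ i))) ⟩
        sumFin p (λ u′ → slack u′ + degR f u′ i) ≡⟨ sum-+ p _ _ ⟩
        sumFin p slack + e                    ≤⟨ +-monoʳ-≤ _ (≮⇒≥ few) ⟩
        sumFin p slack + 2 * W                ∎)

  total : (Fin p → Fin ℓ → ℕ) → ℕ
  total c = sumFin p (λ u → sumFin ℓ (c u))

  saturate : ∀ fuel f → Within f → total a ≤ total (degR f) + fuel →
             ∃ λ f′ → (∀ u i → degR f′ u i ≡ a u i) × (∀ v i → degC f′ v i ≡ b v i)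
  saturate fuel f (R≤ , C≤) enough with any? (λ u → any? (λ i → degR f u i <? a u i))
  -- Once all rows are exact, equality of the two colour totals forces the columns to be exact as
  -- well.
  ... | no none = f , R≡ , λ v i → sum-≤-≥⇒≡ q (λ v → degC f v i) (λ v → b v i) (λ v → C≤ v i)
                    (≤-reflexive (trans (sym (Σa≡Σb i))
                      (trans (sum-cong p (λ u → sym (R≡ u i))) (Σ-degR≡Σ-degC f i)))) v
    where
    R≡ : ∀ u i → degR f u i ≡ a u i
    R≡ u i = ≤-antisym (R≤ u i) (≮⇒≥ (λ lt → none (u , i , lt)))
  saturate zero f (R≤ , C≤) enough | yes (u , i , lt) =
    ⊥-elim (<⇒≱ (sum-mono-< p (λ u → sum-mono ℓ (R≤ u)) u (sum-mono-< ℓ (R≤ u) i lt))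
                (subst (total a ≤_) (+-identityʳ _) enough))
  saturate (suc fuel) f within@(R≤ , C≤) enough | yes (u , i , lt)
    with augment f within u i lt
  ... | f′ , u⁺ , v⁺ , (R+ , C+) , u⁺< , v⁺< =
    saturate fuel f′
      ( (λ w j → subst (_≤ a w j) (sym (R+ w j)) (bump u⁺ w i j (R≤ w j) (λ { refl refl → u⁺< })))
      , (λ w j → subst (_≤ b w j) (sym (C+ w j)) (bump v⁺ w i j (C≤ w j) (λ { refl refl → v⁺< }))) )
      (subst (total a ≤_) (trans (+-suc _ fuel) (cong (_+ fuel) (sym grow))) enough)
    where
    bump : ∀ {n} (x x′ : Fin n) (i i′ : Fin ℓ) {m o} → m ≤ o →
           (x ≡ x′ → i ≡ i′ → m < o) → m + δ x x′ * δ i i′ ≤ o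
    bump x x′ i i′ {m} {o} le lt with x ≟ᶠ x′
    ... | no _  = subst (_≤ o) (sym (+-identityʳ m)) le
    ... | yes e = subst (λ z → m + z ≤ o) (sym (+-identityʳ (δ i i′))) (bump≤ i i′ m o le (lt e))
    grow : total (degR f′) ≡ suc (total (degR f))
    grow = begin
      total (degR f′)
        ≡⟨ sum-cong p (λ w → trans (sum-cong ℓ (R+ w)) (sum-+ ℓ _ _)) ⟩
      sumFin p (λ w → sumFin ℓ (degR f w) + sumFin ℓ (λ j → δ u⁺ w * δ i j))
        ≡⟨ sum-+ p _ _ ⟩
      total (degR f) + sumFin p (λ w → sumFin ℓ (λ j → δ u⁺ w * δ i j))
        ≡⟨ cong (total (degR f) +_) (sum-cong p (λ w →
             trans (sum-*ˡ ℓ (δ u⁺ w) (δ i)) (cong (δ u⁺ w *_) (sum-δ₁ ℓ i)))) ⟩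
      total (degR f) + sumFin p (λ w → δ u⁺ w * 1)
        ≡⟨ cong (total (degR f) +_) (sum-δ p u⁺ (λ _ → 1)) ⟩
      total (degR f) + 1
        ≡⟨ +-comm _ 1 ⟩
      suc (total (degR f)) ∎
      where open ≡-Reasoning

  core : ∃ λ f → (∀ u i → degR f u i ≡ a u i) × (∀ v i → degC f v i ≡ b v i)
  core = saturate (total a) (λ _ _ → nothing)
    ( (λ u i → subst (_≤ a u i) (sym (sum-0 q)) z≤n)
    , (λ v i → subst (_≤ b v i) (sym (sum-0 p)) z≤n) )
    (m≤n+m (total a) _)

-- Completing a single row or column

-- Entries may be filled only in the region `reg`. The field `unfree` protects exact degrees of the
-- perpendicular lines, and `respects` those of the line itself.
record Completes {n ℓ : ℕ} (reg : Fin n → Bool) (fr : Fin n → Fin ℓ → Bool) (d : Fin ℓ → ℕ)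
                 (g g′ : Fin n → Maybe (Fin ℓ)) : Set where
  field
    outside  : ∀ x → reg x ≡ false → g′ x ≡ g x
    extends  : ∀ x i → μ (g x) i ≤ μ (g′ x) i
    unfree   : ∀ x i → fr x i ≡ false → μ (g′ x) i ≡ μ (g x) i
    reaches  : ∀ i → d i ≤ deg g′ i
    respects : ∀ i → deg g i ≤ d i → deg g′ i ≤ d i

module Line {n ℓ : ℕ} (k : ℕ) (reg : Fin n → Bool) (fr : Fin n → Fin ℓ → Bool)
            (d : Fin ℓ → ℕ) (d≤k : ∀ i → d i ≤ k) where

  put : (Fin n → Maybe (Fin ℓ)) → Fin n → Fin ℓ → Fin n → Maybe (Fin ℓ)
  put g x i y = if ⌊ x ≟ᶠ y ⌋ then just i else g y

  μ-put : ∀ g x i → g x ≡ nothing → ∀ y j → μ (put g x i y) j ≡ μ (g y) j + δ x y * δ i j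
  μ-put g x i e y j with x ≟ᶠ y
  ... | yes refl rewrite e = sym (+-identityʳ _)
  ... | no _     = sym (+-identityʳ _)

  Σ-put : ∀ (w : Fin n → ℕ) g x i → g x ≡ nothing → ∀ j →
          sumFin n (λ y → w y * μ (put g x i y) j) ≡ sumFin n (λ y → w y * μ (g y) j) + w x * δ i j
  Σ-put w g x i e j = begin
    sumFin n (λ y → w y * μ (put g x i y) j)
      ≡⟨ sum-cong n (λ y → trans (cong (w y *_) (μ-put g x i e y j)) (expand (w y) _ (δ x y) (δ i j))) ⟩
    sumFin n (λ y → w y * μ (g y) j + δ x y * (w y * δ i j))
      ≡⟨ sum-+ n _ _ ⟩
    sumFin n (λ y → w y * μ (g y) j) + sumFin n (λ y → δ x y * (w y * δ i j))
      ≡⟨ cong (sumFin n (λ y → w y * μ (g y) j) +_) (sum-δ n x (λ y → w y * δ i j)) ⟩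
    sumFin n (λ y → w y * μ (g y) j) + w x * δ i j ∎
    where
    open ≡-Reasoning
    expand : ∀ a b c e → a * (b + c * e) ≡ a * b + c * (a * e)
    expand = solve-∀

  deg-put : ∀ g x i → g x ≡ nothing → ∀ j → deg (put g x i) j ≡ deg g j + δ i j
  deg-put g x i e j = begin
    deg (put g x i) j                           ≡⟨ sum-cong n (λ y → sym (*-identityˡ _)) ⟩
    sumFin n (λ y → 1 * μ (put g x i y) j)      ≡⟨ Σ-put (λ _ → 1) g x i e j ⟩
    sumFin n (λ y → 1 * μ (g y) j) + 1 * δ i j  ≡⟨ cong₂ _+_ (sum-cong n (λ y → *-identityˡ _)) (*-identityˡ _) ⟩
    deg g j + δ i j ∎
    where open ≡-Reasoning

  -- Only the region is counted: completed columns may have put any number of entries into a row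
  -- elsewhere, and these do not obstruct its completion.
  regDeg : (Fin n → Maybe (Fin ℓ)) → Fin ℓ → ℕ
  regDeg g i = sumFin n (λ x → b2n (reg x) * μ (g x) i)

  regDeg≤deg : ∀ g i → regDeg g i ≤ deg g i
  regDeg≤deg g i = sum-mono n (λ x →
    subst (b2n (reg x) * μ (g x) i ≤_) (*-identityˡ _) (*-monoˡ-≤ (μ (g x) i) (b2n≤1 (reg x))))

  Roomy : (Fin n → Maybe (Fin ℓ)) → Set
  Roomy g = ∀ i → deg g i < d i → ℓ * k < sumFin n (λ x → b2n (reg x) * b2n (fr x i))

  -- At most `ℓ * k` positions of the region are coloured, while more than `ℓ * k` of them are free
  -- for `i`.
  available : ∀ g → (∀ i → regDeg g i ≤ k) → Roomy g → ∀ i → deg g i < d i →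
              ∃ λ x → reg x ≡ true × fr x i ≡ true × g x ≡ nothing
  available g load room i lt =
    let x , lt′ = sum-<-witness n (λ x → w x * occ (g x)) w (begin-strict
          sumFin n (λ x → w x * occ (g x))
            ≤⟨ sum-mono n (λ x → *-monoˡ-≤ (occ (g x)) (w≤ x)) ⟩
          sumFin n (λ x → b2n (reg x) * occ (g x))
            ≡⟨ sum-cong n (λ x → trans (cong (b2n (reg x) *_) (occ≡Σμ (g x)))
                                       (sym (sum-*ˡ ℓ (b2n (reg x)) _))) ⟩
          sumFin n (λ x → sumFin ℓ (λ j → b2n (reg x) * μ (g x) j))
            ≡⟨ sum-swap n ℓ _ ⟩
          sumFin ℓ (regDeg g)
            ≤⟨ sum-≤-const ℓ load ⟩
          ℓ * k
            <⟨ room i lt ⟩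
          sumFin n w ∎)
        r , f = both (reg x) (fr x i) (≤-<-trans z≤n lt′)
    in x , r , f , occ<1⇒nothing (g x) (m*n<m⇒n<1 (w x) _ lt′)
    where
    open ≤-Reasoning
    w : Fin n → ℕ
    w x = b2n (reg x) * b2n (fr x i)
    w≤ : ∀ x → w x ≤ b2n (reg x)
    w≤ x = subst (w x ≤_) (*-identityʳ _) (*-monoʳ-≤ (b2n (reg x)) (b2n≤1 (fr x i)))
    both : ∀ r f → 0 < b2n r * b2n f → r ≡ true × f ≡ true
    both true true _ = refl , refl

  deficit : (Fin n → Maybe (Fin ℓ)) → ℕ
  deficit g = sumFin ℓ (λ i → d i ∸ deg g i)

  fill : ∀ fuel g → (∀ i → regDeg g i ≤ k) → Roomy g → deficit g ≤ fuel →
         ∃ (Completes reg fr d g)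
  fill fuel g load room enough with any? (λ i → deg g i <? d i)
  ... | no none = g , record
        { outside  = λ _ _ → refl
        ; extends  = λ _ _ → ≤-refl
        ; unfree   = λ _ _ _ → refl
        ; reaches  = λ i → ≮⇒≥ (λ lt → none (i , lt))
        ; respects = λ _ le → le }
  ... | yes (i , lt) with available g load room i lt
  ... | x , rx , fx , gx = go fuel enough
    where
    g₁ : Fin n → Maybe (Fin ℓ)
    g₁ = put g x i
    deg₁ : ∀ j → deg g₁ j ≡ deg g j + δ i j
    deg₁ = deg-put g x i gx
    grow : ∀ j → deg g j ≤ deg g₁ j
    grow j = subst (deg g j ≤_) (sym (deg₁ j)) (m≤m+n _ _)
    deg₁≤ : ∀ j → deg g j ≤ d j → deg g₁ j ≤ d j
    deg₁≤ j le = subst (_≤ d j) (sym (deg₁ j)) (bump≤ i j _ _ le (λ { refl → lt }))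
    -- Colour `i` was below its demand and so stays within it; the other colours have not changed.
    load₁ : ∀ j → regDeg g₁ j ≤ k
    load₁ j with i ≟ᶠ j
    ... | yes refl = ≤-trans (regDeg≤deg g₁ i) (≤-trans (deg₁≤ i (<⇒≤ lt)) (d≤k i))
    ... | no ne    = subst (_≤ k) (sym (trans (Σ-put (b2n ∘ reg) g x i gx j)
                       (trans (cong (λ z → regDeg g j + b2n (reg x) * z) (δ-≢ ne))
                         (trans (cong (regDeg g j +_) (*-zeroʳ (b2n (reg x)))) (+-identityʳ _)))))
                       (load j)
    deficit₁ : deficit g₁ < deficit g
    deficit₁ = sum-mono-< ℓ (λ j → ∸-monoʳ-≤ (d j) (grow j)) i
      (∸-monoʳ-< (subst (deg g i <_) (sym (trans (deg₁ i) (trans (cong (deg g i +_) (δ-refl i)) (+-comm _ 1)))) (n<1+n _))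
                 (deg₁≤ i (<⇒≤ lt)))
    g₁-≢ : ∀ y → x ≢ y → g₁ y ≡ g y
    g₁-≢ y ne with x ≟ᶠ y
    ... | yes e = ⊥-elim (ne e)
    ... | no _  = refl
    unfree₁ : ∀ y j → fr y j ≡ false → μ (g₁ y) j ≡ μ (g y) j
    unfree₁ y j nf with x ≟ᶠ y
    ... | no _ = refl
    ... | yes refl rewrite gx with i ≟ᶠ j
    ... | yes refl = ⊥-elim (true≢false fx nf)
    ... | no _     = refl
    go : ∀ fuel → deficit g ≤ fuel → ∃ (Completes reg fr d g)
    go zero enough₀ = ⊥-elim (<⇒≱ deficit₁ (≤-trans enough₀ z≤n))
    go (suc fuel) enough₁ =
      let g′ , c = fill fuel g₁ load₁ (λ j lt → room j (≤-<-trans (grow j) lt))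
                     (s≤s⁻¹ (≤-trans deficit₁ enough₁))
          open Completes c
      in g′ , record
        { outside  = λ y nr → trans (outside y nr) (g₁-≢ y (λ { refl → true≢false rx nr }))
        ; extends  = λ y j → ≤-trans (subst (μ (g y) j ≤_) (sym (μ-put g x i gx y j)) (m≤m+n _ _)) (extends y j)
        ; unfree   = λ y j nf → trans (unfree y j nf) (unfree₁ y j nf)
        ; reaches  = reaches
        ; respects = λ j le → respects j (deg₁≤ j le) }

-- Halving every class of a partition

eqᵇ : Bool → Bool → Bool
eqᵇ true  b = b
eqᵇ false b = not b

halve : ∀ p {r} (t : Fin p → Fin r) → ∃ λ (bit : Fin p → Bool) → ∀ a β →
        sumFin p (λ u → δ (t u) a * b2n (eqᵇ (not β) (bit u))) ≤
        suc (sumFin p (λ u → δ (t u) a * b2n (eqᵇ β (bit u))))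
halve zero    t = (λ ()) , λ _ _ → z≤n
halve (suc p) t with halve p (t ∘ suc)
... | bit , balanced = extend (cnt true ≤? cnt false)
  where
  cnt : Bool → ℕ
  cnt β = sumFin p (λ u → δ (t (suc u)) (t zero) * b2n (eqᵇ β (bit u)))
  bal : ∀ β₀ → cnt β₀ ≤ cnt (not β₀) → ∀ a β →
    δ (t zero) a * b2n (eqᵇ (not β) β₀) +
      sumFin p (λ u → δ (t (suc u)) a * b2n (eqᵇ (not β) (bit u))) ≤
    suc (δ (t zero) a * b2n (eqᵇ β β₀) +
      sumFin p (λ u → δ (t (suc u)) a * b2n (eqᵇ β (bit u))))
  bal β₀ le a β with t zero ≟ᶠ a
  bal β₀    le a β     | no _     = balanced a β
  bal true  le a true  | yes refl = ≤-trans (balanced a true) (n≤1+n _)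
  bal false le a true  | yes refl = s≤s le
  bal true  le a false | yes refl = s≤s le
  bal false le a false | yes refl = ≤-trans (balanced a false) (n≤1+n _)
  -- The new element goes to the side that is not ahead in its class.
  extend : Dec (cnt true ≤ cnt false) → ∃ λ (bit : Fin (suc p) → Bool) → ∀ a β →
           sumFin (suc p) (λ u → δ (t u) a * b2n (eqᵇ (not β) (bit u))) ≤
           suc (sumFin (suc p) (λ u → δ (t u) a * b2n (eqᵇ β (bit u))))
  extend (yes le) = (λ { zero → true ; (suc u) → bit u }) , bal true le
  extend (no ¬le) = (λ { zero → false ; (suc u) → bit u }) , bal false (<⇒≤ (≰⇒> ¬le))

-- The two halves of a class differ by at most one, so a large class has many elements on either
-- side.
halve-large : ∀ p {r} (t : Fin p → Fin r) → ∃ λ (bit : Fin p → Bool) → ∀ a β →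
              sumFin p (λ u → δ (t u) a) ≤
              suc (2 * sumFin p (λ u → δ (t u) a * b2n (eqᵇ β (bit u))))
halve-large p t = bit , λ a β → begin
  sumFin p (λ u → δ (t u) a)
    ≡⟨ sum-cong p (λ u → split (δ (t u) a) β (bit u)) ⟩
  sumFin p (λ u → δ (t u) a * b2n (eqᵇ (not β) (bit u)) + δ (t u) a * b2n (eqᵇ β (bit u)))
    ≡⟨ sum-+ p _ _ ⟩
  sumFin p (λ u → δ (t u) a * b2n (eqᵇ (not β) (bit u))) + S a β
    ≤⟨ +-monoˡ-≤ (S a β) (proj₂ (halve p t) a β) ⟩
  suc (S a β) + S a β
    ≡⟨ cong (λ z → suc (S a β + z)) (sym (+-identityʳ (S a β))) ⟩
  suc (2 * S a β) ∎
  where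
  open ≤-Reasoning
  bit : Fin p → Bool
  bit = proj₁ (halve p t)
  S : _ → Bool → ℕ
  S a β = sumFin p (λ u → δ (t u) a * b2n (eqᵇ β (bit u)))
  split : ∀ x β b → x ≡ x * b2n (eqᵇ (not β) b) + x * b2n (eqᵇ β b)
  split x true  true  rewrite *-zeroʳ x = sym (*-identityʳ x)
  split x true  false rewrite *-zeroʳ x | +-identityʳ (x * 1) = sym (*-identityʳ x)
  split x false true  rewrite *-zeroʳ x | +-identityʳ (x * 1) = sym (*-identityʳ x)
  split x false false rewrite *-zeroʳ x = sym (*-identityʳ x)

-- Large instances

positive : ℕ → Bool
positive zero    = false
positive (suc _) = true

b2n-positive≤ : ∀ x → b2n (positive x) ≤ x
b2n-positive≤ zero    = z≤n
b2n-positive≤ (suc x) = s≤s z≤n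

-- A family of demands, one for every element of Fin size.  The label of an
-- element determines for which colours its demand is only a lower bound.
record Side (ℓ k : ℕ) : Set where
  field
    size labels : ℕ
    lab         : Fin size → Fin labels
    free        : Fin labels → Fin ℓ → Bool
    dem         : Fin size → Fin ℓ → ℕ
    dem≤k       : ∀ x i → dem x i ≤ k

  fr : Fin size → Fin ℓ → Bool
  fr x i = free (lab x) i

  -- These are the classes required to be empty or large: first those of the labels, then those of
  -- positive demand for a colour.
  item : Fin (labels + ℓ) → Fin size → Bool
  item c x = [ (λ a → ⌊ lab x ≟ᶠ a ⌋) , (λ i → positive (dem x i)) ]′ (splitAt labels c)

  itemSize : Fin (labels + ℓ) → ℕ
  itemSize c = countFin size (item c)

  Σdem : Fin ℓ → ℕ
  Σdem i = sumFin size (λ x → dem x i)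

  itemSize-label : ∀ a → itemSize (a ↑ˡ ℓ) ≡ sumFin size (λ x → δ (lab x) a)
  itemSize-label a rewrite splitAt-↑ˡ labels a ℓ = refl

  itemSize-colour : ∀ i → itemSize (labels ↑ʳ i) ≡ sumFin size (λ x → b2n (positive (dem x i)))
  itemSize-colour i rewrite splitAt-↑ʳ labels ℓ i = refl

open Side

-- Passes from parts to vertices: along a partition map, each vertex inherits the label and the
-- demands of its part.
pull : ∀ {ℓ k} (S : Side ℓ k) {p} → (Fin p → Fin (size S)) → Side ℓ k
pull S {p} t = record
  { size   = p
  ; labels = labels S
  ; lab    = lab S ∘ t
  ; free   = free S
  ; dem    = dem S ∘ t
  ; dem≤k  = dem≤k S ∘ t }

Meets : Bool → ℕ → ℕ → Set
Meets true  x d = d ≤ x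
Meets false x d = x ≡ d

module _ {ℓ k : ℕ} where

  SolvesRows : (R : Side ℓ k) → ∀ {q} → (Fin (size R) → Fin q → Fin ℓ) → Set
  SolvesRows R {q} f = ∀ u i → Meets (fr R u i) (sumFin q (λ v → δ (f u v) i)) (dem R u i)

  Solves : (R S : Side ℓ k) → (Fin (size R) → Fin (size S) → Fin ℓ) → Set
  Solves R S f = SolvesRows R f × SolvesRows S (flip f)

  -- Target degrees may reach `suc k`, so `threshold` is the size that `Core` needs for this bound.
  -- The summand `3 + 2 * load` of `bound` leaves more than `load` elements in either half of a
  -- class.
  load threshold bound : ℕ
  load      = ℓ * suc k
  threshold = 3 * (suc k * load)
  bound     = suc threshold + (3 + 2 * load)

  -- If no row is free for `i`, the rows carry exactly `Σdem R i` edges of that colour, and these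
  -- have to cover the demands of the columns.
  HalfLarge : (R S : Side ℓ k) → Set
  HalfLarge R S =
    (∀ c → itemSize R c ≡ 0 ⊎ bound ≤ itemSize R c) ×
    (∀ i → 0 < countFin (size R) (λ u → fr R u i) ⊎ Σdem S i ≤ Σdem R i)

  Large : (R S : Side ℓ k) → Set
  Large R S = HalfLarge R S × HalfLarge S R ×
    (∀ a b → itemSize R (a ↑ˡ ℓ) ≡ 0 ⊎ itemSize S (b ↑ˡ ℓ) ≡ 0 ⊎
             ∃ λ i → free R a i ≡ true × free S b i ≡ true)

  label-present : ∀ (R : Side ℓ k) u → itemSize R (lab R u ↑ˡ ℓ) ≢ 0
  label-present R u e = 1+n≰n (begin
    1                                         ≡⟨ sym (δ-refl (lab R u)) ⟩
    δ (lab R u) (lab R u)                     ≤⟨ term≤sum _ (λ x → δ (lab R x) (lab R u)) u ⟩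
    sumFin (size R) (λ x → δ (lab R x) (lab R u)) ≡⟨ sym (itemSize-label R (lab R u)) ⟩
    itemSize R (lab R u ↑ˡ ℓ)                 ≡⟨ e ⟩
    0 ∎)
    where open ≤-Reasoning

  anyFree? : ∀ (R : Side ℓ k) i → Dec (∃ λ u → fr R u i ≡ true)
  anyFree? R i = any? (λ u → fr R u i ≟ᵇ true)

  noneFree : ∀ (R : Side ℓ k) i → ¬ (∃ λ u → fr R u i ≡ true) → ∀ u → fr R u i ≡ false
  noneFree R i none u = ¬true⇒false (λ e → none (u , e))

  count-noneFree : ∀ (R : Side ℓ k) i → (∀ u → fr R u i ≡ false) →
                   countFin (size R) (λ u → fr R u i) ≡ 0
  count-noneFree R i none = trans (sum-cong (size R) (λ u → cong b2n (none u))) (sum-0 (size R))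

  module HalfLargeProps (R S : Side ℓ k) (half : HalfLarge R S) where

    label-large : ∀ u → bound ≤ sumFin (size R) (λ x → δ (lab R x) (lab R u))
    label-large u with proj₁ half (lab R u ↑ˡ ℓ)
    ... | inj₁ z  = ⊥-elim (label-present R u z)
    ... | inj₂ le = subst (bound ≤_) (itemSize-label R (lab R u)) le

    Σdem-large : ∀ i → Σdem R i ≡ 0 ⊎ threshold < Σdem R i
    Σdem-large i with proj₁ half (labels R ↑ʳ i)
    ... | inj₁ z  = inj₁ (trans (sum-cong (size R) (λ u → zero-of (dem R u i)
                      (sum≡0⇒term≡0 (size R) _ (trans (sym (itemSize-colour R i)) z) u)))
                      (sum-0 (size R)))
      where
      zero-of : ∀ x → b2n (positive x) ≡ 0 → x ≡ 0
      zero-of zero _ = refl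
    ... | inj₂ le = inj₂ (≤-trans (m≤m+n _ _) (≤-trans le
                      (subst (_≤ Σdem R i) (sym (itemSize-colour R i))
                        (sum-mono (size R) (λ u → b2n-positive≤ (dem R u i))))))

    balance : ∀ i → (∀ u → fr R u i ≡ false) → Σdem S i ≤ Σdem R i
    balance i none with proj₂ half i
    ... | inj₁ pos = ⊥-elim (<⇒≱ pos (≤-reflexive (count-noneFree R i none)))
    ... | inj₂ le  = le

    -- Freeness depends only on the label, and the class of an occurring label is large.
    free-large : ∀ i u → fr R u i ≡ true → threshold < countFin (size R) (λ x → fr R x i)
    free-large i u e = ≤-trans (m≤m+n _ _) (≤-trans (label-large u)
      (sum-mono (size R) (λ x → le (lab R x) (λ e′ → trans (cong (λ a → free R a i) e′) e))))
      where
      le : ∀ a → (a ≡ lab R u → free R a i ≡ true) → δ a (lab R u) ≤ b2n (free R a i)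
      le a h with a ≟ᶠ lab R u
      ... | yes e′ rewrite h e′ = ≤-refl
      ... | no _ = z≤n

  -- The degrees in colour `i` to be realised before the greedy completions. A completion puts `i`
  -- only where the perpendicular line is free for it; if there is no such line, `aF` and `bF` make
  -- the target cover the demand from the start.
  record Target (R S : Side ℓ k) (i : Fin ℓ) : Set where
    field
      a  : Fin (size R) → ℕ
      b  : Fin (size S) → ℕ
      a≤ : ∀ u → a u ≤ suc k
      b≤ : ∀ v → b v ≤ suc k
      Σ≡ : sumFin (size R) a ≡ sumFin (size S) b
      zl : sumFin (size R) a ≡ 0 ⊎ threshold < sumFin (size R) a
      aU : ∀ u → fr R u i ≡ false → a u ≤ dem R u i
      bU : ∀ v → fr S v i ≡ false → b v ≤ dem S v i
      aF : (∀ v → fr S v i ≡ false) → ∀ u → dem R u i ≤ a u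
      bF : (∀ u → fr R u i ≡ false) → ∀ v → dem S v i ≤ b v

  flip-target : ∀ {R S i} → Target R S i → Target S R i
  flip-target t = record
    { a = b ; b = a ; a≤ = b≤ ; b≤ = a≤ ; Σ≡ = sym Σ≡
    ; zl = subst (λ s → s ≡ 0 ⊎ threshold < s) Σ≡ zl
    ; aU = bU ; bU = aU ; aF = bF ; bF = aF }
    where open Target t

  -- Serves when the completions can supply all of colour `i`, or when nothing has to be supplied.
  zero-target : ∀ {R S i} → ((∀ v → fr S v i ≡ false) → ∀ u → dem R u i ≤ 0) →
                ((∀ u → fr R u i ≡ false) → ∀ v → dem S v i ≤ 0) → Target R S i
  zero-target {R} {S} aF bF = record
    { a = λ _ → 0 ; b = λ _ → 0 ; a≤ = λ _ → z≤n ; b≤ = λ _ → z≤n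
    ; Σ≡ = trans (sum-0 (size R)) (sym (sum-0 (size S))) ; zl = inj₁ (sum-0 (size R))
    ; aU = λ _ _ → z≤n ; bU = λ _ _ → z≤n ; aF = aF ; bF = bF }

  -- No row completion can use `i`, so the rows get their full demand now. The columns stay at or
  -- below their exact demands, and the column completions add the rest in free rows.
  half-free-target : ∀ (R S : Side ℓ k) → HalfLarge R S → HalfLarge S R → ∀ i →
                     (∃ λ u → fr R u i ≡ true) → (∀ v → fr S v i ≡ false) → Target R S i
  half-free-target R S hR hS i (u₀ , free₀) noneS with HalfLargeProps.Σdem-large S R hS i
  ... | inj₁ z = zero-target
          (λ _ u → ≤-trans (term≤sum (size R) (λ u → dem R u i) u)
                     (≤-trans (HalfLargeProps.balance S R hS i noneS) (≤-reflexive z)))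
          (λ none → ⊥-elim (true≢false free₀ (none u₀)))
  ... | inj₂ large =
    let a , lo≤a , a≤hi , Σa = sum-interpolate (size R) lo hi (λ u → m≤m+n _ _) s
                                 (⊓-glb Σlo≤Σd (sum-mono (size R) (λ u → m≤m+n _ _))) (m⊓n≤n _ _)
        b , _ , b≤d , Σb = sum-interpolate (size S) (λ _ → 0) (λ v → dem S v i) (λ _ → z≤n) s
                             (subst (_≤ s) (sym (sum-0 (size S))) z≤n) (m⊓n≤m _ _)
    in record
      { a = a ; b = b
      ; a≤ = λ u → ≤-trans (a≤hi u) (subst (hi u ≤_) (+-comm k 1) (+-mono-≤ (dem≤k R u i) (b2n≤1 (fr R u i))))
      ; b≤ = λ v → ≤-trans (b≤d v) (≤-trans (dem≤k S v i) (n≤1+n k))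
      ; Σ≡ = trans Σa (sym Σb)
      ; zl = inj₂ (subst (threshold <_) (sym Σa) (⊓-glb large (≤-trans
               (HalfLargeProps.free-large R S hR i u₀ free₀)
               (sum-mono (size R) (λ u → m≤n+m (b2n (fr R u i)) (lo u))))))
      ; aU = λ u nf → ≤-trans (a≤hi u)
               (≤-reflexive (trans (cong (λ z → lo u + b2n z) nf) (+-identityʳ (lo u))))
      ; bU = λ v _ → b≤d v
      ; aF = λ _ → lo≤a
      ; bF = λ none → ⊥-elim (true≢false free₀ (none u₀)) }
    where
    lo hi : Fin (size R) → ℕ
    lo u = dem R u i
    hi u = dem R u i + b2n (fr R u i)
    -- A free row may take one edge beyond its demand. Both numbers exceed `threshold`: the first
    -- because it is not zero, the second because there are more than `threshold` free rows.
    s : ℕ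
    s = Σdem S i ⊓ sumFin (size R) hi
    Σlo≤Σd : sumFin (size R) lo ≤ Σdem S i
    Σlo≤Σd = HalfLargeProps.balance S R hS i noneS

  target : ∀ (R S : Side ℓ k) → HalfLarge R S → HalfLarge S R → ∀ i → Target R S i
  target R S hR hS i with anyFree? R i | anyFree? S i
  ... | yes (u , fu) | yes (v , fv) = zero-target
          (λ none → ⊥-elim (true≢false fv (none v))) (λ none → ⊥-elim (true≢false fu (none u)))
  ... | yes fR       | no noS       = half-free-target R S hR hS i fR (noneFree S i noS)
  ... | no noR       | yes fS       = flip-target (half-free-target S R hS hR i fS (noneFree R i noR))
  ... | no noR       | no noS       = record
    { a = λ u → dem R u i ; b = λ v → dem S v i
    ; a≤ = λ u → ≤-trans (dem≤k R u i) (n≤1+n k) ; b≤ = λ v → ≤-trans (dem≤k S v i) (n≤1+n k)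
    ; Σ≡ = ≤-antisym (HalfLargeProps.balance S R hS i (noneFree S i noS))
                     (HalfLargeProps.balance R S hR i (noneFree R i noR))
    ; zl = HalfLargeProps.Σdem-large R S hR i
    ; aU = λ _ _ → ≤-refl ; bU = λ _ _ → ≤-refl ; aF = λ _ _ → ≤-refl ; bF = λ _ _ → ≤-refl }

  -- Assembling the colouring of a large instance

  module Halving (R S : Side ℓ k) (half : HalfLarge R S) where

    bit : Fin (size R) → Bool
    bit = proj₁ (halve-large (size R) (lab R))

    -- The whole label class of `u₀` is free for `i`, and either half of it has more than `load`
    -- elements.
    room : ∀ i → (∃ λ u → fr R u i ≡ true) → ∀ β →
           load < sumFin (size R) (λ u → b2n (eqᵇ β (bit u)) * b2n (fr R u i))
    room i (u₀ , free₀) β = ≤-trans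
      (*-cancelˡ-≤ 2 (begin
        2 * suc load                  ≡⟨ *-suc 2 load ⟩
        2 + 2 * load                  ≤⟨ s≤s⁻¹ (≤-trans (m≤n+m _ (suc threshold)) (≤-trans
                                           (HalfLargeProps.label-large R S half u₀)
                                           (proj₂ (halve-large (size R) (lab R)) (lab R u₀) β))) ⟩
        2 * sumFin (size R) (λ u → δ (lab R u) (lab R u₀) * b2n (eqᵇ β (bit u))) ∎))
      (sum-mono (size R) (λ u → le (lab R u) (eqᵇ β (bit u))
        (λ e → trans (cong (λ a → free R a i) e) free₀)))
      where
      open ≤-Reasoning
      le : ∀ a e → (a ≡ lab R u₀ → free R a i ≡ true) →
           δ a (lab R u₀) * b2n e ≤ b2n e * b2n (free R a i)
      le a e h with a ≟ᶠ lab R u₀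
      ... | no _  = z≤n
      ... | yes q rewrite h q = ≤-reflexive (*-comm 1 (b2n e))

  module Construction (R S : Side ℓ k) (large : Large R S) where
    hR : HalfLarge R S
    hR = proj₁ large
    hS : HalfLarge S R
    hS = proj₁ (proj₂ large)
    opaque
      tgt : ∀ i → Target R S i
      tgt = target R S hR hS

    -- Entries whose row and column have equal bits are reserved for completing columns, the others
    -- for completing rows.
    bR : Fin (size R) → Bool
    bR = Halving.bit R S hR
    bS : Fin (size S) → Bool
    bS = Halving.bit S R hS

    opaque
      f₀-spec : ∃ λ f → (∀ u i → degR f u i ≡ Target.a (tgt i) u) × (∀ v i → degC f v i ≡ Target.b (tgt i) v)
      f₀-spec = Core.core (suc k) (λ u i → Target.a (tgt i) u) (λ v i → Target.b (tgt i) v)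
        (λ u i → Target.a≤ (tgt i) u) (λ v i → Target.b≤ (tgt i) v)
        (λ i → Target.Σ≡ (tgt i)) (λ i → Target.zl (tgt i))

    f₀ : PColouring (size R) (size S) ℓ
    f₀ = proj₁ f₀-spec
    degR₀ : ∀ u i → degR f₀ u i ≡ Target.a (tgt i) u
    degR₀ = proj₁ (proj₂ f₀-spec)
    degC₀ : ∀ v i → degC f₀ v i ≡ Target.b (tgt i) v
    degC₀ = proj₂ (proj₂ f₀-spec)

    opaque
      column : ∀ v → ∃ (Completes (λ u → eqᵇ (bS v) (bR u)) (fr R) (dem S v) (λ u → f₀ u v))
      column v = fill _ g
        (λ i → ≤-trans (regDeg≤deg g i) (subst (_≤ suc k) (sym (degC₀ v i)) (Target.b≤ (tgt i) v)))
        (λ i lt → Halving.room R S hR i (someFree i lt) (bS v)) ≤-refl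
        where
        open Line (suc k) (λ u → eqᵇ (bS v) (bR u)) (fr R) (dem S v)
                  (λ i → ≤-trans (dem≤k S v i) (n≤1+n k))
        g : Fin (size R) → Maybe (Fin ℓ)
        g u = f₀ u v
        someFree : ∀ i → deg g i < dem S v i → ∃ λ u → fr R u i ≡ true
        someFree i lt with anyFree? R i
        ... | yes some = some
        -- Without a free row the target already covers the demand of the column.
        ... | no none  = ⊥-elim (<⇒≱ lt (subst (dem S v i ≤_) (sym (degC₀ v i))
                           (Target.bF (tgt i) (noneFree R i none) v)))
    f₁ : PColouring (size R) (size S) ℓ
    f₁ u v = proj₁ (column v) u
    module Col v = Completes (proj₂ (column v))

    opposite : ∀ x y → eqᵇ (not x) y ≡ true → eqᵇ y x ≡ false
    opposite true  false _ = refl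
    opposite false true  _ = refl

    opaque
      row : ∀ u → ∃ (Completes (λ v → eqᵇ (not (bR u)) (bS v)) (fr S) (dem R u) (f₁ u))
      row u = fill _ (f₁ u)
        -- The column completions left the region of this row untouched, so its load there is at
        -- most the target degree.
        (λ i → ≤-trans (sum-mono (size S) (λ v → untouched i v (eqᵇ (not (bR u)) (bS v)) refl))
                 (subst (_≤ suc k) (sym (degR₀ u i)) (Target.a≤ (tgt i) u)))
        (λ i lt → Halving.room S R hS i (someFree i lt) (not (bR u))) ≤-refl
        where
        open Line (suc k) (λ v → eqᵇ (not (bR u)) (bS v)) (fr S) (dem R u)
                  (λ i → ≤-trans (dem≤k R u i) (n≤1+n k))
        untouched : ∀ i v β → eqᵇ (not (bR u)) (bS v) ≡ β → b2n β * μ (f₁ u v) i ≤ μ (f₀ u v) i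
        untouched i v false e = z≤n
        untouched i v true  e = ≤-reflexive (trans (*-identityˡ _)
          (cong (λ x → μ x i) (Col.outside v u (opposite (bR u) (bS v) e))))
        someFree : ∀ i → deg (f₁ u) i < dem R u i → ∃ λ v → fr S v i ≡ true
        someFree i lt with anyFree? S i
        ... | yes some = some
        ... | no none  = ⊥-elim (<⇒≱ lt (≤-trans (Target.aF (tgt i) (noneFree S i none) u)
                           (≤-trans (≤-reflexive (sym (degR₀ u i)))
                             (sum-mono (size S) (λ v → Col.extends v u i)))))

    f₂ : PColouring (size R) (size S) ℓ
    f₂ u v = proj₁ (row u) v
    module Row u = Completes (proj₂ (row u))

    common : ∀ u v → ∃ λ i → fr R u i ≡ true × fr S v i ≡ true
    common u v with proj₂ (proj₂ large) (lab R u) (lab S v)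
    ... | inj₁ z        = ⊥-elim (label-present R u z)
    ... | inj₂ (inj₁ z) = ⊥-elim (label-present S v z)
    ... | inj₂ (inj₂ c) = c

    complete : Maybe (Fin ℓ) → Fin ℓ → Fin ℓ
    complete (just i) _ = i
    complete nothing  j = j

    μ≤complete : ∀ x j i → μ x i ≤ δ (complete x j) i
    μ≤complete (just _) j i = ≤-refl
    μ≤complete nothing  j i = z≤n

    μ≡complete : ∀ x j i → j ≢ i → μ x i ≡ δ (complete x j) i
    μ≡complete (just _) j i ne = refl
    μ≡complete nothing  j i ne = sym (δ-≢ ne)

    f : Fin (size R) → Fin (size S) → Fin ℓ
    f u v = complete (f₂ u v) (proj₁ (common u v))

    -- A colour not free for `u` is added to this row neither by column completions nor by the final
    -- colouring; the row completion raises it exactly to the demand.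
    rows : SolvesRows R f
    rows u i with fr R u i in e
    ... | true  = ≤-trans (Row.reaches u i) (sum-mono (size S) (λ v → μ≤complete (f₂ u v) _ i))
    ... | false = trans
          (sum-cong (size S) (λ v → sym (μ≡complete (f₂ u v) _ i
            (λ { refl → true≢false (proj₁ (proj₂ (common u v))) e }))))
          (≤-antisym (Row.respects u i (begin
              deg (f₁ u) i      ≡⟨ sum-cong (size S) (λ v → Col.unfree v u i e) ⟩
              degR f₀ u i       ≡⟨ degR₀ u i ⟩
              Target.a (tgt i) u ≤⟨ Target.aU (tgt i) u e ⟩
              dem R u i         ∎))
            (Row.reaches u i))
      where open ≤-Reasoning

    -- Row completions and the final colouring add to column `v` only colours free for it, so the
    -- exact degrees reached by the column completion survive.
    columns : SolvesRows S (flip f)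
    columns v i with fr S v i in e
    ... | true  = ≤-trans (Col.reaches v i) (sum-mono (size R) (λ u →
                    ≤-trans (Row.extends u v i) (μ≤complete (f₂ u v) _ i)))
    ... | false = trans
          (sum-cong (size R) (λ u → trans
            (sym (μ≡complete (f₂ u v) _ i (λ { refl → true≢false (proj₂ (proj₂ (common u v))) e })))
            (Row.unfree u v i e)))
          (≤-antisym (Col.respects v i (≤-trans (≤-reflexive (degC₀ v i)) (Target.bU (tgt i) v e)))
            (Col.reaches v i))

  large⇒solvable : ∀ (R S : Side ℓ k) → Large R S → ∃ (Solves R S)
  large⇒solvable R S large = f , rows , columns
    where open Construction R S large

-- Necessity of the conditions on large instances

Meets⇒≤ : ∀ b {x d} → Meets b x d → d ≤ x
Meets⇒≤ true  le   = le
Meets⇒≤ false refl = ≤-refl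

Meets⇒≡ : ∀ b {x d} → b ≡ false → Meets b x d → x ≡ d
Meets⇒≡ false _ e = e

module _ {ℓ k : ℕ} where

  -- A colour that is not free occurs in the row exactly as often as demanded, hence at most `k`
  -- times.
  Σunfree≤load : ∀ (R : Side ℓ k) {q} (f : Fin (size R) → Fin q → Fin ℓ) → SolvesRows R f → ∀ u →
                 sumFin q (λ v → b2n (not (fr R u (f u v)))) ≤ load {ℓ} {k}
  Σunfree≤load R {q} f solves u = begin
    sumFin q (λ v → w (f u v))
      ≡⟨ sum-cong q (λ v → sym (sum-δ ℓ (f u v) w)) ⟩
    sumFin q (λ v → sumFin ℓ (λ i → δ (f u v) i * w i))
      ≡⟨ sum-swap q ℓ _ ⟩
    sumFin ℓ (λ i → sumFin q (λ v → δ (f u v) i * w i))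
      ≡⟨ sum-cong ℓ (λ i → sum-*ʳ q (w i) _) ⟩
    sumFin ℓ (λ i → sumFin q (λ v → δ (f u v) i) * w i)
      ≤⟨ sum-≤-const ℓ (λ i → le (fr R u i) (solves u i) (dem≤k R u i)) ⟩
    load {ℓ} {k} ∎
    where
    open ≤-Reasoning
    w : Fin ℓ → ℕ
    w i = b2n (not (fr R u i))
    le : ∀ b {x d} → Meets b x d → d ≤ k → x * b2n (not b) ≤ suc k
    le true  {x} _    _   = subst (_≤ suc k) (sym (*-zeroʳ x)) z≤n
    le false {x} refl d≤k = subst (_≤ suc k) (sym (*-identityʳ x)) (≤-trans d≤k (n≤1+n k))

  -- Twice `x * y` is at least `x * (1 + 2 * l) + (1 + 2 * l) * y`, which exceeds
  -- `2 * (x * l + y * l)` by `x + y`.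
  product-large : ∀ x y l → 1 + 2 * l ≤ x → 1 + 2 * l ≤ y → x * l + y * l < x * y
  product-large x y l hx hy = *-cancelˡ-< 2 _ _ (begin-strict
    2 * (x * l + y * l)             <⟨ m<m+n _ (≤-trans (s≤s z≤n) (≤-trans hx (m≤m+n x y))) ⟩
    2 * (x * l + y * l) + (x + y)   ≡⟨ rearrange x y l ⟩
    x * (1 + 2 * l) + (1 + 2 * l) * y ≤⟨ +-mono-≤ (*-monoʳ-≤ x hy) (*-monoˡ-≤ y hx) ⟩
    x * y + x * y                   ≡⟨ cong (x * y +_) (sym (+-identityʳ _)) ⟩
    2 * (x * y)                     ∎)
    where
    open ≤-Reasoning
    rearrange : ∀ x y l → 2 * (x * l + y * l) + (x + y) ≡ x * (1 + 2 * l) + (1 + 2 * l) * y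
    rearrange = solve-∀

  -- A row has boundedly many entries whose colour is not free for it, and
  -- likewise a column; a large block therefore has an entry that is free for both.
  common-free : ∀ (R S : Side ℓ k) f → Solves R S f → ∀ a b →
                bound {ℓ} {k} ≤ itemSize R (a ↑ˡ ℓ) → bound {ℓ} {k} ≤ itemSize S (b ↑ˡ ℓ) →
                ∃ λ i → free R a i ≡ true × free S b i ≡ true
  common-free R S f (rows , cols) a b la lb
    with any? (λ i → (free R a i ≟ᵇ true) ×-dec (free S b i ≟ᵇ true))
  ... | yes c   = c
  ... | no none = ⊥-elim (<⇒≱ (product-large X Y L (large R a la) (large S b lb)) (begin
    X * Y
      ≡⟨ sym (trans (sum-cong _ (λ u → sum-*ˡ _ (x u) y)) (sum-*ʳ _ Y x)) ⟩
    sumFin (size R) (λ u → sumFin (size S) (λ v → x u * y v))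
      ≤⟨ sum-mono _ (λ u → sum-mono _ (λ v → cell u v)) ⟩
    sumFin (size R) (λ u → sumFin (size S) (λ v → x u * wR u v + y v * wS u v))
      ≡⟨ trans (sum-cong (size R) (λ u → sum-+ (size S) (λ v → x u * wR u v) (λ v → y v * wS u v)))
              (sum-+ (size R) _ _) ⟩
    sumFin (size R) (λ u → sumFin (size S) (λ v → x u * wR u v)) +
    sumFin (size R) (λ u → sumFin (size S) (λ v → y v * wS u v))
      ≡⟨ cong₂ _+_ (sum-cong _ (λ u → sum-*ˡ _ (x u) (wR u)))
                   (trans (sum-swap (size R) (size S) _) (sum-cong _ (λ v → sum-*ˡ _ (y v) (λ u → wS u v)))) ⟩
    sumFin (size R) (λ u → x u * sumFin (size S) (wR u)) +
    sumFin (size S) (λ v → y v * sumFin (size R) (λ u → wS u v))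
      ≤⟨ +-mono-≤ (sum-mono _ (λ u → *-monoʳ-≤ (x u) (Σunfree≤load R f rows u)))
                  (sum-mono _ (λ v → *-monoʳ-≤ (y v) (Σunfree≤load S (flip f) cols v))) ⟩
    sumFin (size R) (λ u → x u * L) + sumFin (size S) (λ v → y v * L)
      ≡⟨ cong₂ _+_ (sum-*ʳ _ L x) (sum-*ʳ _ L y) ⟩
    X * L + Y * L ∎))
    where
    open ≤-Reasoning
    L X Y : ℕ
    x : Fin (size R) → ℕ
    y : Fin (size S) → ℕ
    wR wS : Fin (size R) → Fin (size S) → ℕ
    L = load {ℓ} {k}
    x u = δ (lab R u) a
    y v = δ (lab S v) b
    wR u v = b2n (not (fr R u (f u v)))
    wS u v = b2n (not (fr S v (f u v)))
    X = sumFin (size R) x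
    Y = sumFin (size S) y
    large : ∀ (R : Side ℓ k) a → bound {ℓ} {k} ≤ itemSize R (a ↑ˡ ℓ) →
            1 + 2 * L ≤ sumFin (size R) (λ u → δ (lab R u) a)
    large R a le = ≤-trans (≤-trans (m≤n+m _ 2) (m≤n+m _ (suc (threshold {ℓ} {k}))))
                     (subst (bound {ℓ} {k} ≤_) (itemSize-label R a) le)
    -- If the labels share no free colour, every entry of the block can be charged to its row or to
    -- its column.
    cell : ∀ u v → x u * y v ≤ x u * wR u v + y v * wS u v
    cell u v with lab R u ≟ᶠ a | lab S v ≟ᶠ b
    ... | no _     | _        = z≤n
    ... | yes _    | no _     = z≤n
    ... | yes refl | yes refl with free R (lab R u) (f u v) in e₁ | free S (lab S v) (f u v) in e₂
    ... | true  | true  = ⊥-elim (none (f u v , e₁ , e₂))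
    ... | true  | false = ≤-refl
    ... | false | _     = s≤s z≤n

  Items : Side ℓ k → Set
  Items R = ∀ c → itemSize R c ≡ 0 ⊎ bound {ℓ} {k} ≤ itemSize R c

  solvable⇒half : ∀ (R S : Side ℓ k) f → Solves R S f → Items R → HalfLarge R S
  solvable⇒half R S f (rows , cols) items = items , bal
    where
    bal : ∀ i → 0 < countFin (size R) (λ u → fr R u i) ⊎ Σdem S i ≤ Σdem R i
    bal i with anyFree? R i
    ... | yes (u , e) = inj₁ (subst (_≤ countFin (size R) (λ u → fr R u i)) (cong b2n e)
                          (term≤sum (size R) (λ u → b2n (fr R u i)) u))
    ... | no none     = inj₂ (begin
        Σdem S i
          ≤⟨ sum-mono (size S) (λ v → Meets⇒≤ (fr S v i) (cols v i)) ⟩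
        sumFin (size S) (λ v → sumFin (size R) (λ u → δ (f u v) i))
          ≡⟨ sum-swap (size S) (size R) _ ⟩
        sumFin (size R) (λ u → sumFin (size S) (λ v → δ (f u v) i))
          ≡⟨ sum-cong (size R) (λ u → Meets⇒≡ (fr R u i) (noneFree R i none u) (rows u i)) ⟩
        Σdem R i ∎)
      where
      open ≤-Reasoning

  solvable⇒large : ∀ (R S : Side ℓ k) f → Solves R S f → Items R → Items S → Large R S
  solvable⇒large R S f sol itR itS =
    solvable⇒half R S f sol itR , solvable⇒half S R (flip f) (swap sol) itS , com
    where
    com : ∀ a b → itemSize R (a ↑ˡ ℓ) ≡ 0 ⊎ itemSize S (b ↑ˡ ℓ) ≡ 0 ⊎
                  ∃ λ i → free R a i ≡ true × free S b i ≡ true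
    com a b with itR (a ↑ˡ ℓ) | itS (b ↑ˡ ℓ)
    ... | inj₁ z  | _       = inj₁ z
    ... | inj₂ _  | inj₁ z  = inj₂ (inj₁ z)
    ... | inj₂ la | inj₂ lb = inj₂ (inj₂ (common-free R S f sol a b la lb))

  -- Removing a vertex

  Feasible : (R S : Side ℓ k) → (Fin (size R) → ℕ) → (Fin (size S) → ℕ) → Set
  Feasible R S M N = ∃₂ λ p q → Σ (Fin p → Fin (size R)) λ t → Σ (Fin q → Fin (size S)) λ s →
    (∀ j → partSize t j ≡ M j) × (∀ j → partSize s j ≡ N j) × ∃ (Solves (pull R t) (pull S s))

  feasible-swap : ∀ R S {M N} → Feasible R S M N → Feasible S R N M
  feasible-swap R S (p , q , t , s , eM , eN , f , sol) = q , p , s , t , eN , eM , flip f , swap sol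

  coarse : (S : Side ℓ k) → Fin (size S * ℓ) → Fin (size S)
  coarse S t = proj₁ (remQuot {size S} ℓ t)

  colour : (S : Side ℓ k) → Fin (size S * ℓ) → Fin ℓ
  colour S t = proj₂ (remQuot {size S} ℓ t)

  -- Each part is split by the colour of the edge to the removed vertex, and that edge is deducted
  -- from the demand. Labels are kept, so the number of items is unchanged although the number of
  -- parts is multiplied by `ℓ`.
  refine : Side ℓ k → Side ℓ k
  refine S = record
    { size   = size S * ℓ
    ; labels = labels S
    ; lab    = λ t → lab S (coarse S t)
    ; free   = free S
    ; dem    = λ t i → dem S (coarse S t) i ∸ δ (colour S t) i
    ; dem≤k  = λ t i → ≤-trans (m∸n≤m _ (δ (colour S t) i)) (dem≤k S (coarse S t) i) }

  -- The last clause excludes an edge whose colour is not free and has demand zero, a violation that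
  -- the truncated subtraction in `refine` would hide.
  Split : (R S : Side ℓ k) (j : Fin (size R)) (M M′ : Fin (size R) → ℕ)
          (N : Fin (size S) → ℕ) (N′ : Fin (size S * ℓ) → ℕ) → Set
  Split R S j M M′ N N′ =
    (∀ j′ → δ j j′ + M′ j′ ≡ M j′) ×
    (∀ j′ → sumFin (size S * ℓ) (λ t → δ (coarse S t) j′ * N′ t) ≡ N j′) ×
    (∀ i → Meets (fr R j i) (sumFin (size S * ℓ) (λ t → δ (colour S t) i * N′ t)) (dem R j i)) ×
    (∀ t → (fr S (coarse S t) (colour S t) ≡ true ⊎ 0 < dem S (coarse S t) (colour S t)) ⊎ N′ t ≡ 0)

  insert-row : ∀ R S j {M M′ N N′} → Split R S j M M′ N N′ →
               Feasible R (refine S) M′ N′ → Feasible R S M N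
  insert-row R S j {M} {M′} {N} {N′} (sM , sN , sj , valid) (p , q , t , s , eM , eN , f , rows , cols) =
    suc p , q , t⁺ , (λ v → coarse S (s v))
    , (λ j′ → trans (cong (δ j j′ +_) (eM j′)) (sM j′))
    , (λ j′ → trans (count (λ z → δ (coarse S z) j′)) (sN j′))
    , f⁺ , rows⁺
    , (λ v i → residual (fr S (coarse S (s v)) i) (cols v i) (ok v i))
    where
    count : ∀ g → sumFin q (λ v → g (s v)) ≡ sumFin (size S * ℓ) (λ z → g z * N′ z)
    count g = trans (sym (sum-fibre s g)) (sum-cong _ (λ z → cong (g z *_) (eN z)))
    t⁺ : Fin (suc p) → Fin (size R)
    t⁺ zero    = j
    t⁺ (suc u) = t u
    f⁺ : Fin (suc p) → Fin q → Fin ℓ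
    f⁺ zero    v = colour S (s v)
    f⁺ (suc u) v = f u v
    rows⁺ : SolvesRows (pull R t⁺) f⁺
    rows⁺ zero    i = subst (λ x → Meets (fr R j i) x (dem R j i)) (sym (count (λ z → δ (colour S z) i))) (sj i)
    rows⁺ (suc u) i = rows u i
    -- The last clause of `Split` exempts empty parts; the part of an existing vertex is not empty.
    present : ∀ v → N′ (s v) ≢ 0
    present v z = 1+n≰n (subst (1 ≤_) (trans (eN (s v)) z)
      (subst (_≤ partSize s (s v)) (δ-refl (s v)) (term≤sum q (λ v′ → δ (s v′) (s v)) v)))
    ok : ∀ v i → fr S (coarse S (s v)) i ≡ true ⊎ δ (colour S (s v)) i ≤ dem S (coarse S (s v)) i
    ok v i with colour S (s v) ≟ᶠ i | valid (s v)
    ... | no _     | _                = inj₂ z≤n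
    ... | yes refl | inj₁ (inj₁ fv)   = inj₁ fv
    ... | yes refl | inj₁ (inj₂ pos)  = inj₂ pos
    ... | yes refl | inj₂ z           = ⊥-elim (present v z)
    -- For a lower bound the truncation in `d ∸ e` is harmless; an exact demand needs `e ≤ d`.
    residual : ∀ b {x d e} → Meets b x (d ∸ e) → b ≡ true ⊎ e ≤ d → Meets b (e + x) d
    residual true  {e = e} le _         = ≤-trans (m≤n+m∸n _ e) (+-monoʳ-≤ e le)
    residual false refl (inj₂ e≤d)      = m+[n∸m]≡n e≤d

  module Removal (R S : Side ℓ k) {p q : ℕ} (t : Fin (suc p) → Fin (size R)) (s : Fin q → Fin (size S))
                 (f : Fin (suc p) → Fin q → Fin ℓ) (sol : Solves (pull R t) (pull S s) f)
                 (u : Fin (suc p)) where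

    t⁻ : Fin p → Fin (size R)
    t⁻ = t ∘ punchIn u
    s⁻ : Fin q → Fin (size S * ℓ)
    s⁻ v = combine (s v) (f u v)
    f⁻ : Fin p → Fin q → Fin ℓ
    f⁻ = f ∘ punchIn u

    coarse-s⁻ : ∀ v → coarse S (s⁻ v) ≡ s v
    coarse-s⁻ v = cong proj₁ (remQuot-combine (s v) (f u v))
    colour-s⁻ : ∀ v → colour S (s⁻ v) ≡ f u v
    colour-s⁻ v = cong proj₂ (remQuot-combine (s v) (f u v))

    solves⁻ : Solves (pull R t⁻) (pull (refine S) s⁻) f⁻
    solves⁻ = (λ w → proj₁ sol (punchIn u w)) , cols⁻
      where
      residual : ∀ b {x e r d} → x ≡ e + r → Meets b x d → Meets b r (d ∸ e)
      residual true  {e = e} refl le   = m≤n+o⇒m∸n≤o _ e le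
      residual false {e = e} {r} refl refl = sym (m+n∸m≡n e r)
      cols⁻ : SolvesRows (pull (refine S) s⁻) (flip f⁻)
      cols⁻ v i rewrite coarse-s⁻ v | colour-s⁻ v =
        residual (fr S (s v) i) (sum-punchIn p (λ w → δ (f w v) i) u) (proj₂ sol v i)

    split : Split R S (t u) (partSize t) (partSize t⁻) (partSize s) (partSize s⁻)
    split = (λ j → sym (sum-punchIn p (λ w → δ (t w) j) u))
          , (λ j → trans (sum-fibre s⁻ (λ z → δ (coarse S z) j))
                         (sum-cong q (λ v → cong (λ x → δ x j) (coarse-s⁻ v))))
          , (λ i → subst (λ x → Meets (fr R (t u) i) x (dem R (t u) i))
                     (sym (trans (sum-fibre s⁻ (λ z → δ (colour S z) i))
                                 (sum-cong q (λ v → cong (λ x → δ x i) (colour-s⁻ v)))))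
                     (proj₁ sol u i))
          , valid
      where
      valid : ∀ z → (fr S (coarse S z) (colour S z) ≡ true ⊎ 0 < dem S (coarse S z) (colour S z)) ⊎
                    partSize s⁻ z ≡ 0
      valid z with fr S (coarse S z) (colour S z) in e₁ | 0 <? dem S (coarse S z) (colour S z)
      ... | true  | _       = inj₁ (inj₁ refl)
      ... | false | yes pos = inj₁ (inj₂ pos)
      ... | false | no ¬pos = inj₂ (trans (sum-cong q (λ v → δ-≢ (λ { refl → absurd v e₁ ¬pos }))) (sum-0 q))
        where
        -- The edge from `v` to the removed vertex has this colour, so an exact demand for it is at
        -- least one.
        absurd : ∀ v → fr S (coarse S (s⁻ v)) (colour S (s⁻ v)) ≡ false →
                 ¬ (0 < dem S (coarse S (s⁻ v)) (colour S (s⁻ v))) → ⊥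
        absurd v e ¬pos rewrite coarse-s⁻ v | colour-s⁻ v =
          ¬pos (subst (1 ≤_) (Meets⇒≡ (fr S (s v) (f u v)) e (proj₂ sol v (f u v)))
            (subst (_≤ sumFin (suc p) (λ w → δ (f w v) (f u v))) (δ-refl (f u v))
              (term≤sum (suc p) (λ w → δ (f w v) (f u v)) u)))

    itemSize-row : ∀ c → itemSize (pull R t) c ≡ b2n (item R c (t u)) + itemSize (pull R t⁻) c
    itemSize-row c = sum-punchIn p (λ w → b2n (item R c (t w))) u

    -- Labels are inherited and demands can only decrease.
    itemSize-column : ∀ c → itemSize (pull (refine S) s⁻) c ≤ itemSize (pull S s) c
    itemSize-column c = sum-mono q (λ v → le v (splitAt (labels S) c))
      where
      positive-mono : ∀ d e → b2n (positive (d ∸ e)) ≤ b2n (positive d)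
      positive-mono zero    e rewrite 0∸n≡0 e = z≤n
      positive-mono (suc d) e = b2n≤1 _
      le : ∀ v c → b2n ([ (λ a → ⌊ lab S (coarse S (s⁻ v)) ≟ᶠ a ⌋)
                        , (λ i → positive (dem S (coarse S (s⁻ v)) i ∸ δ (colour S (s⁻ v)) i)) ]′ c) ≤
                   b2n ([ (λ a → ⌊ lab S (s v) ≟ᶠ a ⌋) , (λ i → positive (dem S (s v) i)) ]′ c)
      le v (inj₁ a) rewrite coarse-s⁻ v = ≤-refl
      le v (inj₂ i) rewrite coarse-s⁻ v = positive-mono (dem S (s v) i) (δ (colour S (s⁻ v)) i)

  -- The cap makes the potential bounded independently of the number of vertices, and with it the
  -- number of removals and the depth of the formula.
  potential : Side ℓ k → ℕ
  potential R = sumFin (labels R + ℓ) (λ c → bound {ℓ} {k} ⊓ itemSize R c)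

  potential≤ : ∀ R → potential R ≤ (labels R + ℓ) * bound {ℓ} {k}
  potential≤ R = sum-≤-const (labels R + ℓ) (λ c → m⊓n≤m _ _)

  items? : ∀ (R : Side ℓ k) → Items R ⊎ ∃₂ λ c u → itemSize R c < bound {ℓ} {k} × item R c u ≡ true
  items? R with any? (λ c → (0 <? itemSize R c) ×-dec (itemSize R c <? bound {ℓ} {k}))
  ... | yes (c , pos , lt) = inj₂ (c , proj₁ member , lt , proj₂ member)
    where
    is-true : ∀ b → 0 < b2n b → b ≡ true
    is-true true _ = refl
    member : ∃ λ u → item R c u ≡ true
    member = let u , h = sum-<-witness (size R) (λ _ → 0) (b2n ∘ item R c) (subst (_< itemSize R c) (sym (sum-0 (size R))) pos)
             in u , is-true _ h
  ... | no none = inj₁ (λ c → dich c (itemSize R c ≟ 0))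
    where
    dich : ∀ c → Dec (itemSize R c ≡ 0) → itemSize R c ≡ 0 ⊎ bound {ℓ} {k} ≤ itemSize R c
    dich c (yes z) = inj₁ z
    dich c (no nz) = inj₂ (≮⇒≥ (λ lt → none (c , n≢0⇒n>0 nz , lt)))

  -- The class of `c` lies below the cap and loses `u`; no other class grows on either side.
  removal-potential : ∀ (R S : Side ℓ k) {p q} (t : Fin (suc p) → Fin (size R)) (s : Fin q → Fin (size S))
                      f sol u c → itemSize (pull R t) c < bound {ℓ} {k} → item R c (t u) ≡ true →
                      let open Removal R S t s f sol u in
                      potential (pull R t⁻) + potential (pull (refine S) s⁻) <
                      potential (pull R t) + potential (pull S s)
  removal-potential R S {p} t s f sol u c small e = +-mono-<-≤
    (sum-mono-< (labels R + ℓ)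
      (λ c′ → ⊓-monoʳ-≤ B (subst (itemSize (pull R t⁻) c′ ≤_) (sym (itemSize-row c′)) (m≤n+m _ _))) c
      (begin-strict
        B ⊓ itemSize (pull R t⁻) c ≤⟨ m⊓n≤n B _ ⟩
        itemSize (pull R t⁻) c     <⟨ n<1+n _ ⟩
        suc (itemSize (pull R t⁻) c) ≡⟨ sym one-less ⟩
        itemSize (pull R t) c      ≡⟨ sym (m≥n⇒m⊓n≡n (<⇒≤ small)) ⟩
        B ⊓ itemSize (pull R t) c  ∎))
    (sum-mono (labels S + ℓ) (λ c′ → ⊓-monoʳ-≤ B (itemSize-column c′)))
    where
    open ≤-Reasoning
    open Removal R S t s f sol u
    B : ℕ
    B = bound {ℓ} {k}
    one-less : itemSize (pull R t) c ≡ suc (itemSize (pull R t⁻) c)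
    one-less = trans (itemSize-row c) (cong (λ b → b2n b + itemSize (pull R t⁻) c) e)

-- Definability

module _ {X : Set} {K : ℕ} (env : X → Vector ℕ K) where

  Def : (X → Set) → Set
  Def P = Σ (Formula K) λ φ → ∀ x → P x ⇔ Sat φ (env x)

  Lin : (X → ℕ) → Set
  Lin e = Σ (Term K) λ t → ∀ x → ⟦ t ⟧t (env x) ≡ e x

module _ {X : Set} {K : ℕ} {env : X → Vector ℕ K} where

  lin-const : ∀ c → Lin env (λ _ → c)
  lin-const zero    = `0 , λ _ → refl
  lin-const (suc c) = let t , h = lin-const c in `1 `+ t , λ x → cong suc (h x)

  lin-+ : ∀ {d e} → Lin env d → Lin env e → Lin env (λ x → d x + e x)
  lin-+ (t , h) (t′ , h′) = t `+ t′ , λ x → cong₂ _+_ (h x) (h′ x)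

  lin-* : ∀ c {e} → Lin env e → Lin env (λ x → c * e x)
  lin-* zero    l = lin-const 0
  lin-* (suc c) l = lin-+ l (lin-* c l)

  lin-sum : ∀ n {e : Fin n → X → ℕ} → (∀ j → Lin env (e j)) → Lin env (λ x → sumFin n (λ j → e j x))
  lin-sum zero    l = lin-const 0
  lin-sum (suc n) l = lin-+ (l zero) (lin-sum n (l ∘ suc))

  lin-cong : ∀ {d e} → (∀ x → d x ≡ e x) → Lin env d → Lin env e
  lin-cong eq (t , h) = t , λ x → trans (h x) (eq x)

  def-≤ : ∀ {d e} → Lin env d → Lin env e → Def env (λ x → d x ≤ e x)
  def-≤ (t , h) (t′ , h′) = t `≤ t′ , λ x → mk⇔
    (subst₂ _≤_ (sym (h x)) (sym (h′ x))) (subst₂ _≤_ (h x) (h′ x))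

  def-× : ∀ {P Q} → Def env P → Def env Q → Def env (λ x → P x × Q x)
  def-× (φ , h) (ψ , h′) = φ `∧ ψ , λ x → mk⇔
    (map (Equivalence.to (h x)) (Equivalence.to (h′ x)))
    (map (Equivalence.from (h x)) (Equivalence.from (h′ x)))

  def-⊎ : ∀ {P Q} → Def env P → Def env Q → Def env (λ x → P x ⊎ Q x)
  def-⊎ (φ , h) (ψ , h′) = φ `∨ ψ , λ x → mk⇔
    (Data.Sum.map (Equivalence.to (h x)) (Equivalence.to (h′ x)))
    (Data.Sum.map (Equivalence.from (h x)) (Equivalence.from (h′ x)))

  def-≡ : ∀ {d e} → Lin env d → Lin env e → Def env (λ x → d x ≡ e x)
  def-≡ l l′ with def-× (def-≤ l l′) (def-≤ l′ l)
  ... | φ , h = φ , λ x → mk⇔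
    (λ e → Equivalence.to (h x) (≤-reflexive e , ≤-reflexive (sym e)))
    (λ s → uncurry ≤-antisym (Equivalence.from (h x) s))

  -- The statement does not depend on `x`, so it is decided while the formula is being built.
  def-dec : ∀ {A : Set} → Dec A → Def env (λ _ → A)
  def-dec (yes a) = `0 `≤ `0 , λ _ → mk⇔ (λ _ → z≤n) (λ _ → a)
  def-dec (no ¬a) = `1 `≤ `0 , λ _ → mk⇔ (⊥-elim ∘ ¬a) λ ()

  def-∀ : ∀ n {P : Fin n → X → Set} → (∀ j → Def env (P j)) → Def env (λ x → ∀ j → P j x)
  def-∀ zero    d = `0 `≤ `0 , λ _ → mk⇔ (λ _ → z≤n) (λ _ ())
  def-∀ (suc n) d with def-× (d zero) (def-∀ n (d ∘ suc))
  ... | φ , h = φ , λ x → mk⇔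
    (λ p → Equivalence.to (h x) (p zero , p ∘ suc))
    (λ s → λ { zero    → proj₁ (Equivalence.from (h x) s)
             ; (suc j) → proj₂ (Equivalence.from (h x) s) j })

  def-Meets : ∀ b {e d} → Lin env e → Lin env d → Def env (λ x → Meets b (e x) (d x))
  def-Meets true  l l′ = def-≤ l′ l
  def-Meets false l l′ = def-≡ l l′

-- Finite disjunctions, quantifier blocks and vertex sets of given part sizes

⋁ : ∀ n {K} → (Fin n → Formula K) → Formula K
⋁ zero    φ = `1 `≤ `0
⋁ (suc n) φ = φ zero `∨ ⋁ n (φ ∘ suc)

Sat-⋁⁺ : ∀ n {K} (φ : Fin n → Formula K) {ρ} j → Sat (φ j) ρ → Sat (⋁ n φ) ρ
Sat-⋁⁺ (suc n) φ zero    s = inj₁ s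
Sat-⋁⁺ (suc n) φ (suc j) s = inj₂ (Sat-⋁⁺ n (φ ∘ suc) j s)

Sat-⋁⁻ : ∀ n {K} (φ : Fin n → Formula K) {ρ} → Sat (⋁ n φ) ρ → ∃ λ j → Sat (φ j) ρ
Sat-⋁⁻ (suc n) φ (inj₁ s) = zero , s
Sat-⋁⁻ (suc n) φ (inj₂ s) = let j , s′ = Sat-⋁⁻ n (φ ∘ suc) s in suc j , s′

∃ⁿ : ∀ m {K} → Formula (m + K) → Formula K
∃ⁿ zero    φ = φ
∃ⁿ (suc m) φ = ∃ⁿ m (`∃ φ)

-- Unlike _++_, this concatenation unfolds along with the quantifier prefix of ∃ⁿ.
_⊕_ : ∀ {m K} → Vector ℕ m → Vector ℕ K → Vector ℕ (m + K)
_⊕_ {zero}  N ρ = ρ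
_⊕_ {suc m} N ρ = N zero ∷ ((N ∘ suc) ⊕ ρ)

⊕-↑ˡ : ∀ {m K} (N : Vector ℕ m) (ρ : Vector ℕ K) j → (N ⊕ ρ) (j ↑ˡ K) ≡ N j
⊕-↑ˡ N ρ zero    = refl
⊕-↑ˡ N ρ (suc j) = ⊕-↑ˡ (N ∘ suc) ρ j

⊕-↑ʳ : ∀ {m K} (N : Vector ℕ m) (ρ : Vector ℕ K) j → (N ⊕ ρ) (m ↑ʳ j) ≡ ρ j
⊕-↑ʳ {zero}  N ρ j = refl
⊕-↑ʳ {suc m} N ρ j = ⊕-↑ʳ (N ∘ suc) ρ j

Sat-∃ⁿ⁺ : ∀ m {K} (φ : Formula (m + K)) {ρ} (N : Vector ℕ m) → Sat φ (N ⊕ ρ) → Sat (∃ⁿ m φ) ρ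
Sat-∃ⁿ⁺ zero    φ N s = s
Sat-∃ⁿ⁺ (suc m) φ N s = Sat-∃ⁿ⁺ m (`∃ φ) (N ∘ suc) (N zero , s)

Sat-∃ⁿ⁻ : ∀ m {K} (φ : Formula (m + K)) {ρ} → Sat (∃ⁿ m φ) ρ → ∃ λ N → Sat φ (N ⊕ ρ)
Sat-∃ⁿ⁻ zero    φ s = (λ ()) , s
Sat-∃ⁿ⁻ (suc m) φ s = let N , x , s′ = Sat-∃ⁿ⁻ m (`∃ φ) s in x ∷ N , s′

-- Vertices are added one at a time to a part whose prescribed size is not yet exhausted.
realise : ∀ {m} s (M : Fin m → ℕ) → sumFin m M ≡ s →
          ∃ λ p → Σ (Fin p → Fin m) λ t → ∀ j → partSize t j ≡ M j
realise {m} zero    M e = 0 , (λ ()) , λ j → sym (sum≡0⇒term≡0 m M e j)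
realise {m} (suc s) M e =
  let j , pos = sum-<-witness m (λ _ → 0) M (subst₂ _<_ (sym (sum-0 m)) (sym e) (s≤s z≤n))
      M⁻ : Fin m → ℕ
      M⁻ j′ = M j′ ∸ δ j j′
      back : ∀ j′ → δ j j′ + M⁻ j′ ≡ M j′
      back j′ = m+[n∸m]≡n (bump≤ j j′ 0 (M j′) z≤n (λ { refl → pos }))
      p , t , h = realise s M⁻ (suc-injective (trans
        (trans (cong (_+ sumFin m M⁻) (sym (sum-δ₁ m j))) (sym (sum-+ m (δ j) M⁻)))
        (trans (sum-cong m back) e)))
  in suc p , (j ∷ t) , λ j′ → trans (cong (δ j j′ +_) (h j′)) (back j′)

-- The formula

module _ {ℓ k : ℕ} where

  -- Conditions on vertices become definable over such pairs of an environment and vertex sets: the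
  -- formula sees only the part sizes, stored at the positions `σ` and `τ`.
  record World (R S : Side ℓ k) {K} (σ : Fin (size R) → Fin K) (τ : Fin (size S) → Fin K) : Set where
    field
      ρ   : Vector ℕ K
      p q : ℕ
      t   : Fin p → Fin (size R)
      s   : Fin q → Fin (size S)
      eM  : ∀ j → partSize t j ≡ ρ (σ j)
      eN  : ∀ j → partSize s j ≡ ρ (τ j)

  -- Grouping the vertices by part turns the sum into a linear form in the part sizes with fixed
  -- coefficients `g j`.
  lin-fibre : ∀ {X : Set} {K m} {env : X → Vector ℕ K} (σ : Fin m → Fin K)
              (p : X → ℕ) (t : ∀ x → Fin (p x) → Fin m) →
              (∀ x j → partSize (t x) j ≡ env x (σ j)) → ∀ g →
              Lin env (λ x → sumFin (p x) (λ u → g (t x u)))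
  lin-fibre {m = m} {env} σ p t h g = lin-cong
    (λ x → trans (sum-cong m (λ j → cong (g j *_) (sym (h x j)))) (sum-fibre (t x) g))
    (lin-sum m (λ j → lin-* (g j) (var (σ j) , λ _ → refl)))

  module _ {X : Set} {K : ℕ} {env : X → Vector ℕ K} (R S : Side ℓ k)
    (p q : X → ℕ) (t : ∀ x → Fin (p x) → Fin (size R)) (s : ∀ x → Fin (q x) → Fin (size S))
    (linR : (g : Fin (size R) → ℕ) → Lin env (λ x → sumFin (p x) (λ u → g (t x u))))
    (linS : (g : Fin (size S) → ℕ) → Lin env (λ x → sumFin (q x) (λ v → g (s x v)))) where

    def-HalfLarge : Def env (λ x → HalfLarge (pull R (t x)) (pull S (s x)))
    def-HalfLarge = def-×
      (def-∀ (labels R + ℓ) (λ c → def-⊎ (def-≡ (linR (λ j → b2n (item R c j))) (lin-const 0))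
                                         (def-≤ (lin-const _) (linR (λ j → b2n (item R c j))))))
      (def-∀ ℓ (λ i → def-⊎ (def-≤ (lin-const 1) (linR (λ j → b2n (fr R j i))))
                            (def-≤ (linS (λ j → dem S j i)) (linR (λ j → dem R j i)))))

    def-common : Def env (λ x → ∀ a b →
      itemSize (pull R (t x)) (a ↑ˡ ℓ) ≡ 0 ⊎ itemSize (pull S (s x)) (b ↑ˡ ℓ) ≡ 0 ⊎
      ∃ λ i → free R a i ≡ true × free S b i ≡ true)
    def-common = def-∀ (labels R) λ a → def-∀ (labels S) λ b →
      def-⊎ (def-≡ (linR (λ j → b2n (item R (a ↑ˡ ℓ) j))) (lin-const 0))
     (def-⊎ (def-≡ (linS (λ j → b2n (item S (b ↑ˡ ℓ) j))) (lin-const 0))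
            (def-dec (any? (λ i → (free R a i ≟ᵇ true) ×-dec (free S b i ≟ᵇ true)))))

  def-Large : ∀ (R S : Side ℓ k) {K} (σ : Fin (size R) → Fin K) (τ : Fin (size S) → Fin K) →
              Def (World.ρ {R} {S} {K} {σ} {τ}) (λ w → Large (pull R (World.t w)) (pull S (World.s w)))
  def-Large R S σ τ = def-×
    (def-HalfLarge R S World.p World.q World.t World.s linR linS)
    (def-× (def-HalfLarge S R World.q World.p World.s World.t linS linR)
           (def-common R S World.p World.q World.t World.s linR linS))
    where
    linR : ∀ g → Lin World.ρ (λ w → sumFin (World.p w) (λ u → g (World.t w u)))
    linR = lin-fibre σ World.p World.t World.eM
    linS : ∀ g → Lin World.ρ (λ w → sumFin (World.q w) (λ v → g (World.s w v)))
    linS = lin-fibre τ World.q World.s World.eN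

  module Step (R S : Side ℓ k) (j : Fin (size R)) {K : ℕ}
              (σ : Fin (size R) → Fin K) (τ : Fin (size S) → Fin K) where

    m n K⁺ : ℕ
    m  = size R
    n  = size S * ℓ
    K⁺ = n + (m + K)

    Env : Set
    Env = Vector ℕ K × Vector ℕ m × Vector ℕ n

    -- `N′` stands first because `step` quantifies it innermost.
    env : Env → Vector ℕ K⁺
    env (ρ , M′ , N′) = N′ ⊕ (M′ ⊕ ρ)

    σ⁺ : Fin m → Fin K⁺
    σ⁺ j = n ↑ʳ (j ↑ˡ K)
    τ⁺ : Fin n → Fin K⁺
    τ⁺ t = t ↑ˡ (m + K)

    env-σ⁺ : ∀ x j → env x (σ⁺ j) ≡ proj₁ (proj₂ x) j
    env-σ⁺ (ρ , M′ , N′) j = trans (⊕-↑ʳ N′ (M′ ⊕ ρ) (j ↑ˡ K)) (⊕-↑ˡ M′ ρ j)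
    env-τ⁺ : ∀ x t → env x (τ⁺ t) ≡ proj₂ (proj₂ x) t
    env-τ⁺ (ρ , M′ , N′) t = ⊕-↑ˡ N′ (M′ ⊕ ρ) t
    env-old : ∀ x y → env x (n ↑ʳ (m ↑ʳ y)) ≡ proj₁ x y
    env-old (ρ , M′ , N′) y = trans (⊕-↑ʳ N′ (M′ ⊕ ρ) (m ↑ʳ y)) (⊕-↑ʳ M′ ρ y)

    old : ∀ y → Lin env (λ x → proj₁ x y)
    old y = var (n ↑ʳ (m ↑ʳ y)) , λ x → env-old x y
    M-lin : ∀ j → Lin env (λ x → proj₁ (proj₂ x) j)
    M-lin j = var (σ⁺ j) , λ x → env-σ⁺ x j
    N-lin : ∀ t → Lin env (λ x → proj₂ (proj₂ x) t)
    N-lin t = var (τ⁺ t) , λ x → env-τ⁺ x t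

    def-Split : Def env (λ (ρ , M′ , N′) → Split R S j (ρ ∘ σ) M′ (ρ ∘ τ) N′)
    def-Split =
      def-× (def-∀ m (λ j′ → def-≡ (lin-+ (lin-const (δ j j′)) (M-lin j′)) (old (σ j′))))
     (def-× (def-∀ (size S) (λ j′ → def-≡ (lin-sum n (λ t → lin-* (δ (coarse S t) j′) (N-lin t))) (old (τ j′))))
     (def-× (def-∀ ℓ (λ i → def-Meets (fr R j i) (lin-sum n (λ t → lin-* (δ (colour S t) i) (N-lin t)))
                                      (lin-const (dem R j i))))
            (def-∀ n (λ t → def-⊎
              (def-⊎ (def-dec (fr S (coarse S t) (colour S t) ≟ᵇ true))
                     (def-dec (0 <? dem S (coarse S t) (colour S t))))
              (def-≡ (N-lin t) (lin-const 0))))))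

    step : Formula K⁺ → Formula K
    step φ = ∃ⁿ m (∃ⁿ n (proj₁ def-Split `∧ φ))

    step⁺ : ∀ φ ρ M′ N′ → Split R S j (ρ ∘ σ) M′ (ρ ∘ τ) N′ → Sat φ (env (ρ , M′ , N′)) → Sat (step φ) ρ
    step⁺ φ ρ M′ N′ sp s = Sat-∃ⁿ⁺ m (∃ⁿ n (proj₁ def-Split `∧ φ)) M′
      (Sat-∃ⁿ⁺ n (proj₁ def-Split `∧ φ) N′ (Equivalence.to (proj₂ def-Split (ρ , M′ , N′)) sp , s))

    step⁻ : ∀ φ ρ → Sat (step φ) ρ →
            ∃₂ λ M′ N′ → Split R S j (ρ ∘ σ) M′ (ρ ∘ τ) N′ × Sat φ (env (ρ , M′ , N′))
    step⁻ φ ρ st =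
      let M′ , st′    = Sat-∃ⁿ⁻ m (∃ⁿ n (proj₁ def-Split `∧ φ)) st
          N′ , sp , s = Sat-∃ⁿ⁻ n (proj₁ def-Split `∧ φ) st′
      in M′ , N′ , Equivalence.from (proj₂ def-Split (ρ , M′ , N′)) sp , s

  open Step using (step)

  -- A column is removed by exchanging the two sides, so `step` treats rows only. Soundness holds
  -- for every fuel; completeness needs fuel at least the potential.
  form : ℕ → (R S : Side ℓ k) → ∀ {K} → (Fin (size R) → Fin K) → (Fin (size S) → Fin K) → Formula K
  form zero       R S σ τ = proj₁ (def-Large R S σ τ)
  form (suc fuel) R S σ τ = proj₁ (def-Large R S σ τ) `∨
    (⋁ (size R) (λ j → step R S j σ τ (form fuel R (refine S) (Step.σ⁺ R S j σ τ) (Step.τ⁺ R S j σ τ))) `∨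
     ⋁ (size S) (λ j → step S R j τ σ (form fuel S (refine R) (Step.σ⁺ S R j τ σ) (Step.τ⁺ S R j τ σ))))

  feasible-cong : ∀ R S {M M′ N N′} → (∀ j → M j ≡ M′ j) → (∀ j → N j ≡ N′ j) →
                  Feasible {ℓ} {k} R S M N → Feasible R S M′ N′
  feasible-cong R S e e′ (p , q , t , s , eM , eN , sol) =
    p , q , t , s , (λ j → trans (eM j) (e j)) , (λ j → trans (eN j) (e′ j)) , sol

  -- The truth of the formula depends only on the part sizes, so any vertex sets with these sizes
  -- will do.
  Large-sound : ∀ R S {K} (σ : Fin (size R) → Fin K) (τ : Fin (size S) → Fin K) ρ →
                Sat (proj₁ (def-Large R S σ τ)) ρ → Feasible R S (ρ ∘ σ) (ρ ∘ τ)
  Large-sound R S σ τ ρ st =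
    let p , t , eM = realise _ (ρ ∘ σ) refl
        q , s , eN = realise _ (ρ ∘ τ) refl
        w = record { ρ = ρ ; p = p ; q = q ; t = t ; s = s ; eM = eM ; eN = eN }
    in p , q , t , s , eM , eN ,
       large⇒solvable (pull R t) (pull S s) (Equivalence.from (proj₂ (def-Large R S σ τ) w) st)

  sound : ∀ fuel R S {K} (σ : Fin (size R) → Fin K) (τ : Fin (size S) → Fin K) ρ →
          Sat (form fuel R S σ τ) ρ → Feasible R S (ρ ∘ σ) (ρ ∘ τ)
  step-sound : ∀ fuel R S j {K} (σ : Fin (size R) → Fin K) (τ : Fin (size S) → Fin K) ρ →
               Sat (step R S j σ τ (form fuel R (refine S) (Step.σ⁺ R S j σ τ) (Step.τ⁺ R S j σ τ))) ρ →
               Feasible R S (ρ ∘ σ) (ρ ∘ τ)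
  sound zero       R S σ τ ρ st = Large-sound R S σ τ ρ st
  sound (suc fuel) R S σ τ ρ (inj₁ st) = Large-sound R S σ τ ρ st
  sound (suc fuel) R S σ τ ρ (inj₂ (inj₁ st)) =
    let j , st′ = Sat-⋁⁻ (size R) _ st in step-sound fuel R S j σ τ ρ st′
  sound (suc fuel) R S σ τ ρ (inj₂ (inj₂ st)) =
    let j , st′ = Sat-⋁⁻ (size S) _ st in feasible-swap S R (step-sound fuel S R j τ σ ρ st′)
  step-sound fuel R S j σ τ ρ st =
    let M′ , N′ , sp , st′ = step⁻ _ ρ st
    in insert-row R S j sp (feasible-cong R (refine S) (env-σ⁺ (ρ , M′ , N′)) (env-τ⁺ (ρ , M′ , N′))
         (sound fuel R (refine S) σ⁺ τ⁺ (env (ρ , M′ , N′)) st′))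
    where open Step R S j σ τ

  Split-cong : ∀ (R S : Side ℓ k) j {M₁ M₂ M′ N₁ N₂ N′} → (∀ x → M₁ x ≡ M₂ x) → (∀ x → N₁ x ≡ N₂ x) →
               Split R S j M₁ M′ N₁ N′ → Split R S j M₂ M′ N₂ N′
  Split-cong R S j e e′ (sM , sN , rest) =
    (λ x → trans (sM x) (e x)) , (λ x → trans (sN x) (e′ x)) , rest

  flip-world : ∀ {R S K} {σ : Fin (size R) → Fin K} {τ : Fin (size S) → Fin K} → World R S σ τ → World S R τ σ
  flip-world w = record { ρ = ρ ; t = s ; s = t ; eM = eN ; eN = eM }
    where open World w

  potential>0 : ∀ (R : Side ℓ k) c u → item R c u ≡ true → 0 < potential R
  potential>0 R c u e = ≤-trans {j = bound {ℓ} {k} ⊓ itemSize R c}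
    (⊓-glb (s≤s z≤n)
      (subst (_≤ itemSize R c) (cong b2n e) (term≤sum (size R) (b2n ∘ item R c) u)))
    (term≤sum (labels R + ℓ) (λ c → bound {ℓ} {k} ⊓ itemSize R c) c)

  complete : ∀ fuel R S {K} (σ : Fin (size R) → Fin K) (τ : Fin (size S) → Fin K) (w : World R S σ τ) →
             let open World w in ∀ f → Solves (pull R t) (pull S s) f →
             potential (pull R t) + potential (pull S s) ≤ fuel → Sat (form fuel R S σ τ) ρ
  remove : ∀ fuel R S {K} (σ : Fin (size R) → Fin K) (τ : Fin (size S) → Fin K) (w : World R S σ τ) →
           let open World w in ∀ f → Solves (pull R t) (pull S s) f →
           potential (pull R t) + potential (pull S s) ≤ suc fuel →
           ∀ c u → itemSize (pull R t) c < bound {ℓ} {k} → item R c (t u) ≡ true →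
           Sat (⋁ (size R) (λ j → step R S j σ τ
             (form fuel R (refine S) (Step.σ⁺ R S j σ τ) (Step.τ⁺ R S j σ τ)))) ρ
  complete fuel R S σ τ w f sol le with items? (pull R (World.t w)) | items? (pull S (World.s w))
  complete fuel R S σ τ w f sol le | inj₁ itR | inj₁ itS = large-case fuel
    where
    st : Sat (proj₁ (def-Large R S σ τ)) (World.ρ w)
    st = Equivalence.to (proj₂ (def-Large R S σ τ) w)
           (solvable⇒large (pull R (World.t w)) (pull S (World.s w)) f sol itR itS)
    large-case : ∀ fuel → Sat (form fuel R S σ τ) (World.ρ w)
    large-case zero    = st
    large-case (suc _) = inj₁ st
  -- A member of a class makes the potential positive, contrary to the zero bound.
  complete zero R S σ τ w f sol le | inj₂ (c , u , _ , e) | _ =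
    ⊥-elim (<⇒≱ (potential>0 (pull R (World.t w)) c u e) (≤-trans (m≤m+n _ _) le))
  complete (suc fuel) R S σ τ w f sol le | inj₂ (c , u , small , e) | _ =
    inj₂ (inj₁ (remove fuel R S σ τ w f sol le c u small e))
  complete zero R S σ τ w f sol le | inj₁ _ | inj₂ (c , v , _ , e) =
    ⊥-elim (<⇒≱ (potential>0 (pull S (World.s w)) c v e) (≤-trans (m≤n+m _ (potential (pull R (World.t w)))) le))
  complete (suc fuel) R S σ τ w f sol le | inj₁ _ | inj₂ (c , v , small , e) =
    inj₂ (inj₂ (remove fuel S R τ σ (flip-world w) (flip f) (swap sol)
      (subst (_≤ suc fuel) (+-comm (potential (pull R (World.t w))) _) le) c v small e))
  remove fuel R S σ τ record { ρ = ρ ; p = suc p ; t = t ; s = s ; eM = eM ; eN = eN }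
         f sol le c u small e =
    -- The quantified sizes are read off the given colouring: they are the part sizes after deleting
    -- `u` and splitting the columns by their colour at `u`.
    Sat-⋁⁺ (size R) _ (t u) (step⁺ _ ρ (partSize t⁻) (partSize s⁻) (Split-cong R S (t u) eM eN split)
      (complete fuel R (refine S) σ⁺ τ⁺
        (record { ρ = env ρ⁻ ; t = t⁻ ; s = s⁻
                ; eM = λ j → sym (env-σ⁺ ρ⁻ j) ; eN = λ j → sym (env-τ⁺ ρ⁻ j) })
        f⁻ solves⁻ (s≤s⁻¹ (≤-trans (removal-potential R S t s f sol u c small e) le))))
    where
    open Removal R S t s f sol u
    open Step R S (t u) σ τ
    ρ⁻ : Env
    ρ⁻ = ρ , partSize t⁻ , partSize s⁻

-- Encoding of the matrices

isFree : 𝔹 → Bool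
isFree (exactly _) = false
isFree (atLeast _) = true

value : 𝔹 → ℕ
value (exactly d) = d
value (atLeast d) = d

≐⇒Meets : ∀ b {x} → x ≐ b → Meets (isFree b) x (value b)
≐⇒Meets (exactly d) e = e
≐⇒Meets (atLeast d) e = e

Meets⇒≐ : ∀ b {x} → Meets (isFree b) x (value b) → x ≐ b
Meets⇒≐ (exactly d) e = e
Meets⇒≐ (atLeast d) e = e

Σvalue : ∀ {ℓ m} → (Fin ℓ → Fin m → 𝔹) → ℕ
Σvalue {ℓ} {m} C = sumFin ℓ (λ i → sumFin m (λ j → value (C i j)))

value≤Σvalue : ∀ {ℓ m} (C : Fin ℓ → Fin m → 𝔹) i j → value (C i j) ≤ Σvalue C
value≤Σvalue {ℓ} {m} C i j =
  ≤-trans (term≤sum m (λ j → value (C i j)) j) (term≤sum ℓ (λ i → sumFin m (λ j → value (C i j))) i)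

side : ∀ {ℓ m} (C : Fin ℓ → Fin m → 𝔹) k → Σvalue C ≤ k → Side ℓ k
side {m = m} C k le = record
  { size   = m
  ; labels = m
  ; lab    = id
  ; free   = λ j i → isFree (C i j)
  ; dem    = λ j i → value (C i j)
  ; dem≤k  = λ j i → ≤-trans (value≤Σvalue C i j) le }

-- By disjointness, the colour supplied by completeness is the only one at `u v`.
complete-colour : ∀ {ℓ} (G : BipGraph ℓ) (c : Complete G) i u v →
                  BipGraph.E G i u v ≡ ⌊ proj₁ (c u v) ≟ᶠ i ⌋
complete-colour G c i u v with proj₁ (c u v) ≟ᶠ i
... | yes refl = proj₂ (c u v)
... | no ne    = BipGraph.disjoint G (proj₁ (c u v)) i u v ne (proj₂ (c u v))

colouringGraph : ∀ {ℓ p q} → (Fin p → Fin q → Fin ℓ) → BipGraph ℓ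
colouringGraph {p = p} {q} f = record
  { p = p ; q = q
  ; E = λ i u v → ⌊ f u v ≟ᶠ i ⌋
  ; disjoint = λ i j u v → exclusive (f u v) i j }
  where
  exclusive : ∀ {n} (x i j : Fin n) → i ≢ j → ⌊ x ≟ᶠ i ⌋ ≡ true → ⌊ x ≟ᶠ j ⌋ ≡ false
  exclusive x i j ne e with x ≟ᶠ i | x ≟ᶠ j
  ... | yes refl | yes refl = ⊥-elim (ne refl)
  ... | yes _    | no _     = refl
  exclusive x i j ne () | no _ | _

theorem4 : (ℓ m n : ℕ) (C : Fin ℓ → Fin m → 𝔹) (D : Fin ℓ → Fin n → 𝔹) →
    Σ (Formula (m + n)) λ φ →
    (M : Vector ℕ m) (N : Vector ℕ n) →
    ExistsCompleteBiregular C D M N ⇔ Sat φ (M ++ N)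
theorem4 ℓ m n C D = φ , λ M N → mk⇔ (to M N) (from M N)
  where
  k : ℕ
  k = Σvalue C + Σvalue D
  R S : Side ℓ k
  R = side C k (m≤m+n _ _)
  S = side D k (m≤n+m _ _)
  -- Bounds the initial potential for all part sizes at once, since it involves only the numbers of
  -- labels and colours and the cap.
  fuel : ℕ
  fuel = (m + ℓ) * bound {ℓ} {k} + (n + ℓ) * bound {ℓ} {k}
  φ : Formula (m + n)
  φ = form fuel R S (_↑ˡ n) (m ↑ʳ_)

  to : ∀ M N → ExistsCompleteBiregular C D M N → Sat φ (M ++ N)
  to M N (G , c , partU , partV , eM , eN , dU , dV) =
    complete fuel R S (_↑ˡ n) (m ↑ʳ_)
      (record { ρ = M ++ N ; t = partU ; s = partV
              ; eM = λ j → trans (eM j) (sym (lookup-++ˡ M N j))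
              ; eN = λ j → trans (eN j) (sym (lookup-++ʳ M N j)) })
      (λ u v → proj₁ (c u v))
      ( (λ u i → ≐⇒Meets (C i (partU u))
          (subst (_≐ C i (partU u)) (sum-cong q (λ v → cong b2n (complete-colour G c i u v))) (dU i u)))
      , (λ v i → ≐⇒Meets (D i (partV v))
          (subst (_≐ D i (partV v)) (sum-cong p (λ u → cong b2n (complete-colour G c i u v))) (dV i v))) )
      (+-mono-≤ (potential≤ (pull R partU)) (potential≤ (pull S partV)))
    where open BipGraph G

  from : ∀ M N → Sat φ (M ++ N) → ExistsCompleteBiregular C D M N
  from M N st =
    let p , q , t , s , eM , eN , f , rows , cols = sound fuel R S (_↑ˡ n) (m ↑ʳ_) (M ++ N) st
    in colouringGraph f , (λ u v → f u v , isYes-refl (f u v)) , t , s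
     , (λ j → trans (eM j) (lookup-++ˡ M N j)) , (λ j → trans (eN j) (lookup-++ʳ M N j))
     , (λ i u → Meets⇒≐ (C i (t u)) (rows u i)) , (λ i v → Meets⇒≐ (D i (s v)) (cols v i))
    where
    isYes-refl : ∀ {n} (x : Fin n) → ⌊ x ≟ᶠ x ⌋ ≡ true
    isYes-refl x with x ≟ᶠ x
    ... | yes _ = refl
    ... | no ne = ⊥-elim (ne refl)
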